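{- Let $G$ be a Dehn-Sommerville $q$-manifold with vertex set $V(G)$, let $k\ge 1$, $A_k=\{0,1,\dots,k\}$, and let $g:V(G)\to A_k$ be an arbitrary function. Extend $g$ to $G$ by $g(x)=\{g(v): v\in x\}$ and put $G_g=\{x\in G: g(x)=A_k\}$. If $G_g$ is non-empty, then $G_g$ is a Dehn-Sommerville $(q-k)$-manifold.
   Context: A finite abstract simplicial complex $G$ is a finite set of non-empty finite sets closed under taking non-empty subsets; its vertices are its one-element sets (identified with their elements). For $x\in G$, $\omega(x)=(-1)^{|x|-1}$ and $\chi(A)=\sum_{x\in A}\omega(x)$ for $A\subset G$. The star of $x$ is $U(x)=\{y\in G: x\subset y\}$, $\overline{U(x)}=\{z\in G: z\subset y\text{ for some }y\in U(x)\}$, and the unit sphere is $S(x)=\overline{U(x)}\setminus U(x)$. The empty complex is the Dehn-Sommerville $(-1)$-sphere; for $q\ge 0$ a non-empty complex is a Dehn-Sommerville $q$-manifold if every unit sphere is a Dehn-Sommerville $(q-1)$-sphere, and a Dehn-Sommerville $q$-sphere is a Dehn-Sommerville $q$-manifold with $\chi=1+(-1)^q$. Graph version: for a finite simple graph, the unit sphere of a vertex $v$ is the subgraph induced by the neighbours of $v$; the Euler characteristic of a graph is that of its Whitney complex (the set of vertex sets of its non-empty complete subgraphs). The empty graph is the Dehn-Sommerville $(-1)$-sphere graph; for $q\ge0$ a non-empty graph is a Dehn-Sommerville $q$-manifold graph if every unit sphere is a Dehn-Sommerville $(q-1)$-sphere graph, and a Dehn-Sommerville $q$-sphere graph is a Dehn-Sommerville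 $q$-manifold graph with Euler characteristic $1+(-1)^q$. A subset $U\subset G$ (such as $G_g$, which is a union of stars) is called a Dehn-Sommerville $m$-manifold if the graph with vertex set $U$ and edges $\{x,y\}$ for distinct $x,y\in U$ with $x\subset y$ or $y\subset x$ is a Dehn-Sommerville $m$-manifold graph. -}

module Defs where

open import Data.Nat using (ℕ; zero; suc)
open import Data.Bool using (Bool; true; false; not; _∧_; _∨_; if_then_else_)
import Data.Bool as B
open import Data.Integer using (ℤ; +_; -_; _+_)
open import Data.List using (List; []; _∷_; map; foldr; filterᵇ; allFin; _++_)
open import Data.Bool.ListAction using (all; any)
open import Data.Fin using (Fin)
import Data.Fin as F
open import Data.Fin.Subset using (Subset; ∣_∣; _⊆_; _∈_; Nonempty)
open import Data.Fin.Subset.Properties using (_⊆?_)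
open import Data.Vec using (Vec; []; _∷_; lookup)
open import Data.Vec.Properties using (≡-dec)
open import Data.Product using (∃; _×_)
import Data.Empty.Polymorphic
import Data.List.Relation.Unary.All
import Data.List
open import Relation.Nullary using (does)
open import Relation.Binary.PropositionalEquality using (_≡_)

negOnePow : ℕ → ℤ
negOnePow zero    = + 1
negOnePow (suc m) = - negOnePow m

omegaCard : ℕ → ℤ
omegaCard zero    = + 0      -- never used: simplices / cliques are non-empty
omegaCard (suc c) = negOnePow c

sumℤ : List ℤ → ℤ
sumℤ = foldr _+_ (+ 0)

subsets : (n : ℕ) → List (Subset n)
subsets zero    = [] ∷ []
subsets (suc n) = map (true ∷_) (subsets n) ++ map (false ∷_) (subsets n)

sublists : ∀ {a} {A : Set a} → List A → List (List A)
sublists []       = [] ∷ []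
sublists (x ∷ xs) = map (x ∷_) (sublists xs) ++ sublists xs

_⊆ᵇ_ : ∀ {n} → Subset n → Subset n → Bool
x ⊆ᵇ y = does (x ⊆? y)

_≡ᵇ_ : ∀ {n} → Subset n → Subset n → Bool
x ≡ᵇ y = does (≡-dec B._≟_ x y)

SetOfSets : ℕ → Set
SetOfSets n = Subset n → Bool

IsComplex : ∀ {n} → SetOfSets n → Set
IsComplex {n} G =
  ((x : Subset n) → G x ≡ true → Nonempty x) ×
  ((x y : Subset n) → G y ≡ true → Nonempty x → x ⊆ y → G x ≡ true)

chi : ∀ {n} → SetOfSets n → ℤ
chi {n} A = sumℤ (map (λ x → if A x then omegaCard ∣ x ∣ else + 0) (subsets n))

starClosure : ∀ {n} → SetOfSets n → Subset n → SetOfSets n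
starClosure {n} A x z = A z ∧ any (λ y → A y ∧ (x ⊆ᵇ y) ∧ (z ⊆ᵇ y)) (subsets n)

unitSphere : ∀ {n} → SetOfSets n → Subset n → SetOfSets n
unitSphere A x z = starClosure A x z ∧ not (x ⊆ᵇ z)

-- Dehn–Sommerville spheres and manifolds (set-of-sets version).
-- DSSphere d A : A is a Dehn–Sommerville (d-1)-sphere.
-- DSManifold q A : A is a Dehn–Sommerville q-manifold.
mutual
  DSSphere : ∀ {n} → ℕ → SetOfSets n → Set
  DSSphere {n} zero    A = (x : Subset n) → A x ≡ false
  DSSphere     (suc q) A = DSManifold q A × chi A ≡ + 1 + negOnePow q

  DSManifold : ∀ {n} → ℕ → SetOfSets n → Set
  DSManifold {n} q A =
    (∃ λ (x : Subset n) → A x ≡ true) ×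
    ((x : Subset n) → A x ≡ true → DSSphere q (unitSphere A x))

-- Graph version.  A finite simple graph is given by a duplicate-free list
-- of vertices vs together with a symmetric irreflexive Boolean adjacency
-- relation adj; a subgraph induced on a sublist keeps the same adj.

module _ {a} {V : Set a} (adj : V → V → Bool) where

  isClique : List V → Bool
  isClique []       = true
  isClique (x ∷ xs) = all (adj x) xs ∧ isClique xs

  chiGraph : List V → ℤ
  chiGraph vs = sumℤ (map w (sublists vs))
    where
    w : List V → ℤ
    w []         = + 0
    w s@(_ ∷ _)  = if isClique s then omegaCard (Data.List.length s) else + 0

  graphUnitSphere : List V → V → List V
  graphUnitSphere vs v = filterᵇ (adj v) vs

  -- GDSSphere d vs : (vs, adj) is a Dehn–Sommerville (d-1)-sphere graph
  -- GDSManifold q vs : (vs, adj) is a Dehn–Sommerville q-manifold graph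
  mutual
    GDSSphere : ℕ → List V → Set a
    GDSSphere zero    vs = vs ≡ []
    GDSSphere (suc q) vs = GDSManifold q vs × chiGraph vs ≡ + 1 + negOnePow q

    GDSManifold : ℕ → List V → Set a
    GDSManifold q []         = Data.Empty.Polymorphic.⊥
    GDSManifold q vs@(_ ∷ _) =
      Data.List.Relation.Unary.All.All (λ v → GDSSphere q (graphUnitSphere vs v)) vs

fullColour : ∀ {n k} → (Fin n → Fin (suc k)) → Subset n → Bool
fullColour {n} {k} g x =
  all (λ c → any (λ v → lookup x v ∧ does (g v F.≟ c)) (allFin n)) (allFin (suc k))

Gg : ∀ {n k} → SetOfSets n → (Fin n → Fin (suc k)) → SetOfSets n
Gg G g x = G x ∧ fullColour g x

GgList : ∀ {n k} → SetOfSets n → (Fin n → Fin (suc k)) → List (Subset n)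
GgList {n} G g = filterᵇ (Gg G g) (subsets n)

containAdj : ∀ {n} → Subset n → Subset n → Bool
containAdj x y = not (x ≡ᵇ y) ∧ ((x ⊆ᵇ y) ∨ (y ⊆ᵇ x))

{-# OPTIONS --safe #-}

-- The unit sphere of x in G_g is the join of the posets {y ⊊ x : g(y) = A_k} and {y ∈ G : x ⊊ y}.
-- Both are Dehn–Sommerville spheres, of dimensions |x| - k - 2 and q - |x|, by induction: unit
-- spheres in each of them split again, into a smaller poset of the same kind joined with an open
-- Boolean interval, and joins of Dehn–Sommerville spheres are Dehn–Sommerville spheres.  Summing
-- over the tops of chains, the Euler characteristics come from three alternating sums of (-1)^|y|:
-- 0 over a closed Boolean interval, (-1)^(k+1) over the y ⊆ x using all k+1 colours, and
-- (-1)^(q+1) over the star of x in G; the last one holds as the closed star is a cone and the unit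
-- sphere has the prescribed Euler characteristic.
module Submission where

open import Defs
open import Data.Bool using (Bool; true; false; T; _∧_; if_then_else_)
import Data.Bool as Bool
open import Data.Bool.ListAction using (all; any)
open import Data.Bool.Properties using (T-≡; T-∧)
open import Data.Empty using (⊥-elim)
open import Data.Fin using (Fin; zero; suc)
import Data.Fin.Properties as Fin
open import Data.Fin.Subset
  using (Subset; ∣_∣; _⊆_; _⊂_; _⊄_; _∪_; ⊥; ⊤; ⁅_⁆; Nonempty)
  renaming (_∈_ to _∈ˢ_; _∉_ to _∉ˢ_; _-_ to _∖_)
open import Data.Fin.Subset.Properties
open import Data.Integer using (ℤ; +_; -_; _+_; _*_; _-_)
open import Data.Integer.Properties using (+-identityˡ; +-identityʳ; neg-involutive)
open import Data.Integer.Tactic.RingSolver using (solve-∀)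
open import Data.List using (List; []; _∷_; map; filter; filterᵇ; length; allFin; _++_)
open import Data.List.Membership.Propositional using (_∈_; lose)
open import Data.List.Membership.Propositional.Properties
  using (∈-filter⁺; ∈-filter⁻; ∈-++⁺ˡ; ∈-++⁺ʳ; ∈-map⁺; ∈-allFin)
open import Data.List.Properties
  using (map-cong; map-∘; filter-accept; filter-reject; filter-all; filter-≐; length-filter)
open import Data.List.Relation.Unary.All using (All; []; _∷_)
import Data.List.Relation.Unary.All as All
import Data.List.Relation.Unary.All.Properties as All
open import Data.List.Relation.Unary.AllPairs using (AllPairs; []; _∷_)
import Data.List.Relation.Unary.AllPairs as AllPairs
import Data.List.Relation.Unary.AllPairs.Properties as AllPairs
open import Data.List.Relation.Unary.Any using (here; there; satisfied)
open import Data.List.Relation.Unary.Any.Properties using (any⁺; any⁻)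
open import Data.Nat using (ℕ; zero; suc; _≤_; _∸_)
import Data.Nat as ℕ
import Data.Nat.Properties as ℕ
open import Data.Product using (∃; ∃₂; _×_; _,_; proj₁; proj₂; map₂)
open import Data.Sum using (_⊎_; inj₁; inj₂; [_,_])
open import Data.Vec using (lookup; []; _∷_)
open import Data.Vec.Base using (here; there)
open import Data.Vec.Properties using (≡-dec; []=⇒lookup; lookup⇒[]=)
open import Function using (_∘_; id; Equivalence)
open import Level using (0ℓ)
open import Relation.Binary.PropositionalEquality
  using (_≡_; _≢_; refl; sym; trans; cong; cong₂; subst; module ≡-Reasoning)
open import Relation.Nullary using (¬_; Dec; yes; no; does; contradiction; _×-dec_; _→-dec_)
open import Relation.Nullary.Decidable using (¬?; T?)
open import Relation.Unary using (Pred; Decidable)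

-- Signs and finite sums

-- The quantity carried through the inductions is `e` = 1 - χ. It takes the value (-1)^d on every
-- `Sphere d`, where the index d stands for dimension d - 1. With this shift the indices of the two
-- factors of a join simply add, and the empty sphere is the neutral factor. The hypothesis on G
-- speaks of set-theoretic unit spheres S(x), the conclusion of graphs of comparable sets, and the
-- two recursions are not matched with each other. The recursive structure of S(x) enters only to
-- show that every maximal simplex has q + 1 elements, and χ(S(x)) only in the sign sum of a star.
-- Everything else is rebuilt inside the comparability graph. The count of chains collapses to sums
-- of (-1)^|y| because the part below y is, by induction, a sphere whose dimension differs from |y|
-- by a constant. Its `e` is thus a fixed sign times (-1)^|y|, and summing over the tops leaves a
-- single alternating sum.

sign-+ : ∀ a b → negOnePow (a ℕ.+ b) ≡ negOnePow a * negOnePow b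
sign-+ zero b = identity (negOnePow b)
  where
  identity : ∀ z → z ≡ + 1 * z
  identity = solve-∀
sign-+ (suc a) b = trans (cong -_ (sign-+ a b)) (neg-* (negOnePow a) (negOnePow b))
  where
  neg-* : ∀ y z → - (y * z) ≡ - y * z
  neg-* = solve-∀

sign-square : ∀ a → negOnePow a * negOnePow a ≡ + 1
sign-square zero = refl
sign-square (suc a) = trans (neg-*-neg (negOnePow a)) (sign-square a)
  where
  neg-*-neg : ∀ z → - z * - z ≡ z * z
  neg-*-neg = solve-∀

-- Strips the sign of a base size p from the sign of a size p + d. This evaluates `e` of a sphere
-- whose index is an excess of one size over another.
sign-absorb : ∀ p d → negOnePow p * negOnePow (p ℕ.+ d) ≡ negOnePow d
sign-absorb p d = begin
  negOnePow p * negOnePow (p ℕ.+ d)             ≡⟨ cong (negOnePow p *_) (sign-+ p d) ⟩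
  negOnePow p * (negOnePow p * negOnePow d)     ≡⟨ assoc (negOnePow p) (negOnePow d) ⟩
  negOnePow p * negOnePow p * negOnePow d       ≡⟨ cong (_* negOnePow d) (sign-square p) ⟩
  + 1 * negOnePow d                             ≡⟨ identity (negOnePow d) ⟩
  negOnePow d                                   ∎
  where
  open ≡-Reasoning
  assoc : ∀ x y → x * (x * y) ≡ x * x * y
  assoc = solve-∀
  identity : ∀ x → + 1 * x ≡ x
  identity = solve-∀

sign-absorb-suc : ∀ p d → - negOnePow p * negOnePow (suc (p ℕ.+ d)) ≡ negOnePow d
sign-absorb-suc p d = trans (neg-neg (negOnePow p) (negOnePow (p ℕ.+ d))) (sign-absorb p d)
  where
  neg-neg : ∀ x y → - x * - y ≡ x * y
  neg-neg = solve-∀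

+-isolate : ∀ x y {z} → x + y ≡ z → y ≡ z - x
+-isolate x y refl = identity x y
  where
  identity : ∀ x y → y ≡ x + y - x
  identity = solve-∀

when : Bool → ℤ → ℤ
when b z = if b then z else + 0

module _ {A : Set} where

  ∑ : List A → (A → ℤ) → ℤ
  ∑ xs f = sumℤ (map f xs)

  ∑-cong : ∀ {f g : A → ℤ} → (∀ x → f x ≡ g x) → ∀ xs → ∑ xs f ≡ ∑ xs g
  ∑-cong f≗g xs = cong sumℤ (map-cong f≗g xs)

  ∑-cong-All : ∀ {f g : A → ℤ} {xs} → All (λ x → f x ≡ g x) xs → ∑ xs f ≡ ∑ xs g
  ∑-cong-All [] = refl
  ∑-cong-All (eq ∷ eqs) = cong₂ _+_ eq (∑-cong-All eqs)

  ∑-++ : ∀ (f : A → ℤ) xs ys → ∑ (xs ++ ys) f ≡ ∑ xs f + ∑ ys f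
  ∑-++ f [] ys = sym (+-identityˡ _)
  ∑-++ f (x ∷ xs) ys = trans (cong (_+_ (f x)) (∑-++ f xs ys)) (assoc (f x) (∑ xs f) (∑ ys f))
    where
    assoc : ∀ a b c → a + (b + c) ≡ a + b + c
    assoc = solve-∀

  ∑-+ : ∀ (f g : A → ℤ) xs → ∑ xs (λ x → f x + g x) ≡ ∑ xs f + ∑ xs g
  ∑-+ f g [] = refl
  ∑-+ f g (x ∷ xs) =
    trans (cong (_+_ (f x + g x)) (∑-+ f g xs)) (interchange (f x) (g x) (∑ xs f) (∑ xs g))
    where
    interchange : ∀ a b c d → a + b + (c + d) ≡ a + c + (b + d)
    interchange = solve-∀

  ∑-*ˡ : ∀ c (f : A → ℤ) xs → ∑ xs (λ x → c * f x) ≡ c * ∑ xs f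
  ∑-*ˡ c f [] = *-zero c
    where
    *-zero : ∀ z → + 0 ≡ z * + 0
    *-zero = solve-∀
  ∑-*ˡ c f (x ∷ xs) = trans (cong (_+_ (c * f x)) (∑-*ˡ c f xs)) (distrib c (f x) (∑ xs f))
    where
    distrib : ∀ a b c → a * b + a * c ≡ a * (b + c)
    distrib = solve-∀

  ∑-neg : ∀ (f : A → ℤ) xs → ∑ xs (λ x → - f x) ≡ - ∑ xs f
  ∑-neg f [] = refl
  ∑-neg f (x ∷ xs) = trans (cong (_+_ (- f x)) (∑-neg f xs)) (distrib (f x) (∑ xs f))
    where
    distrib : ∀ a b → - a + - b ≡ - (a + b)
    distrib = solve-∀

  ∑-zero : ∀ (xs : List A) → ∑ xs (λ _ → + 0) ≡ + 0
  ∑-zero [] = refl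
  ∑-zero (x ∷ xs) = trans (+-identityˡ _) (∑-zero xs)

  ∑-filter : ∀ {P : Pred A 0ℓ} (P? : Decidable P) f xs →
             ∑ (filter P? xs) f ≡ ∑ xs (λ x → when (does (P? x)) (f x))
  ∑-filter P? f [] = refl
  ∑-filter P? f (x ∷ xs) with does (P? x)
  ... | true  = cong (_+_ (f x)) (∑-filter P? f xs)
  ... | false = trans (∑-filter P? f xs) (sym (+-identityˡ _))

∑-map : ∀ {A B : Set} (f : A → ℤ) (h : B → A) xs → ∑ (map h xs) f ≡ ∑ xs (f ∘ h)
∑-map f h xs = cong sumℤ (sym (map-∘ xs))

-- Filters

module _ {A : Set} where

  filter-cong-∈ : ∀ {P Q : Pred A 0ℓ} (P? : Decidable P) (Q? : Decidable Q) {xs} →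
                  (∀ {x} → x ∈ xs → P x → Q x) → (∀ {x} → x ∈ xs → Q x → P x) →
                  filter P? xs ≡ filter Q? xs
  filter-cong-∈ P? Q? {[]} P⇒Q Q⇒P = refl
  filter-cong-∈ P? Q? {x ∷ xs} P⇒Q Q⇒P with P? x
  ... | yes px = trans (cong (x ∷_) (filter-cong-∈ P? Q? (P⇒Q ∘ there) (Q⇒P ∘ there)))
                       (sym (filter-accept Q? (P⇒Q (here refl) px)))
  ... | no ¬px = trans (filter-cong-∈ P? Q? (P⇒Q ∘ there) (Q⇒P ∘ there))
                       (sym (filter-reject Q? (¬px ∘ Q⇒P (here refl))))

  filter-filter : ∀ {P Q R : Pred A 0ℓ} (P? : Decidable P) (Q? : Decidable Q) (R? : Decidable R) →
                  (∀ {x} → P x → Q x → R x) → (∀ {x} → R x → P x × Q x) →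
                  ∀ xs → filter P? (filter Q? xs) ≡ filter R? xs
  filter-filter P? Q? R? PQ⇒R R⇒PQ [] = refl
  filter-filter P? Q? R? PQ⇒R R⇒PQ (x ∷ xs) with Q? x
  ... | no ¬qx = trans (filter-filter P? Q? R? PQ⇒R R⇒PQ xs)
                       (sym (filter-reject R? (¬qx ∘ proj₂ ∘ R⇒PQ)))
  ... | yes qx with P? x
  ...   | yes px = trans (cong (x ∷_) (filter-filter P? Q? R? PQ⇒R R⇒PQ xs))
                         (sym (filter-accept R? (PQ⇒R px qx)))
  ...   | no ¬px = trans (filter-filter P? Q? R? PQ⇒R R⇒PQ xs)
                         (sym (filter-reject R? (¬px ∘ proj₁ ∘ R⇒PQ)))

  filter-comm : ∀ {P Q : Pred A 0ℓ} (P? : Decidable P) (Q? : Decidable Q) xs →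
                filter P? (filter Q? xs) ≡ filter Q? (filter P? xs)
  filter-comm P? Q? [] = refl
  filter-comm P? Q? (x ∷ xs) with does (P? x) in p | does (Q? x) in q
  ... | true  | true  rewrite p | q = cong (x ∷_) (filter-comm P? Q? xs)
  ... | true  | false rewrite q = filter-comm P? Q? xs
  ... | false | true  rewrite p = filter-comm P? Q? xs
  ... | false | false = filter-comm P? Q? xs

  filter-all-∈ : ∀ {P : Pred A 0ℓ} (P? : Decidable P) {xs} → (∀ {x} → x ∈ xs → P x) → filter P? xs ≡ xs
  filter-all-∈ P? all = filter-all P? (All.tabulate all)

  []-unique : ∀ {xs : List A} → (∀ {x} → ¬ x ∈ xs) → xs ≡ []
  []-unique {[]} none = refl
  []-unique {x ∷ xs} none = contradiction (here refl) none

-- Dehn–Sommerville graphs and joins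

module _ {V : Set} (adj : V → V → Bool) where

  cliqueSign : List V → ℤ
  cliqueSign s = when (isClique adj s) (negOnePow (length s))

  -- One minus the Euler characteristic: the empty clique is counted too.
  e : List V → ℤ
  e vs = ∑ (sublists vs) cliqueSign

  link : V → List V → List V
  link v = filter (T? ∘ adj v)

  -- A non-empty clique has opposite weights in `chiGraph` and in `e`, so in the sum of the two only
  -- the empty clique survives, with value 1.
  chiGraph≡1-e : ∀ vs → chiGraph adj vs ≡ + 1 - e vs
  chiGraph≡1-e vs =
    trans (cong sumℤ (map-cong (λ { [] → refl ; (_ ∷ _) → refl }) (sublists vs)))
          (trans (x+y-y (∑ (sublists vs) weight) (e vs)) (cong (_- e vs) (weight+e vs)))
    where
    weight : List V → ℤ
    weight [] = + 0
    weight s@(_ ∷ _) = when (isClique adj s) (omegaCard (length s))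

    x+y-y : ∀ x y → x ≡ x + y - y
    x+y-y = solve-∀

    weight-∷ : ∀ v s → weight (v ∷ s) ≡ - cliqueSign (v ∷ s)
    weight-∷ v s with isClique adj (v ∷ s)
    ... | true  = sym (neg-involutive _)
    ... | false = refl

    cancel : ∀ x y z → - x + y + (x + z) ≡ y + z
    cancel = solve-∀

    weight+e : ∀ vs → ∑ (sublists vs) weight + e vs ≡ + 1
    weight+e [] = refl
    weight+e (v ∷ vs) = begin
      ∑ (map (v ∷_) S ++ S) weight + ∑ (map (v ∷_) S ++ S) cliqueSign
        ≡⟨ cong₂ _+_ (∑-++ weight (map (v ∷_) S) S) (∑-++ cliqueSign (map (v ∷_) S) S) ⟩
      ∑ (map (v ∷_) S) weight + ∑ S weight + (∑ (map (v ∷_) S) cliqueSign + e vs)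
        ≡⟨ cong₂ (λ x y → x + ∑ S weight + (y + e vs))
             (trans (∑-map weight (v ∷_) S)
                    (trans (∑-cong (weight-∷ v) S) (∑-neg (cliqueSign ∘ (v ∷_)) S)))
             (∑-map cliqueSign (v ∷_) S) ⟩
      - ∑ S (cliqueSign ∘ (v ∷_)) + ∑ S weight + (∑ S (cliqueSign ∘ (v ∷_)) + e vs)
        ≡⟨ cancel (∑ S (cliqueSign ∘ (v ∷_))) (∑ S weight) (e vs) ⟩
      ∑ S weight + e vs
        ≡⟨ weight+e vs ⟩
      + 1 ∎
      where
      open ≡-Reasoning
      S = sublists vs

  ∑-sublists-all : ∀ (p : V → Bool) (f : List V → ℤ) vs →
                   ∑ (sublists vs) (λ s → when (all p s) (f s)) ≡ ∑ (sublists (filterᵇ p vs)) f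
  ∑-sublists-all p f [] = refl
  ∑-sublists-all p f (v ∷ vs) =
    trans (∑-++ F (map (v ∷_) S) S)
          (trans (cong₂ _+_ (∑-map F (v ∷_) S) (∑-sublists-all p f vs)) first)
    where
    S = sublists vs
    F = λ s → when (all p s) (f s)
    first : ∑ S (F ∘ (v ∷_)) + ∑ (sublists (filterᵇ p vs)) f ≡ ∑ (sublists (filterᵇ p (v ∷ vs))) f
    first with p v
    ... | true  = trans (cong₂ _+_ (trans (∑-sublists-all p (f ∘ (v ∷_)) vs) (sym (∑-map f (v ∷_) S′))) refl)
                        (sym (∑-++ f (map (v ∷_) S′) S′))
      where S′ = sublists (filterᵇ p vs)
    ... | false = trans (cong (_+ ∑ (sublists (filterᵇ p vs)) f) (∑-zero S)) (+-identityˡ _)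

  -- A clique through `v` is `v` added to a clique of its link, and the extra vertex flips the sign.
  e-∷ : ∀ v vs → e (v ∷ vs) ≡ e vs - e (link v vs)
  e-∷ v vs = begin
    ∑ (map (v ∷_) S ++ S) cliqueSign              ≡⟨ ∑-++ cliqueSign (map (v ∷_) S) S ⟩
    ∑ (map (v ∷_) S) cliqueSign + e vs            ≡⟨ cong (_+ e vs) (∑-map cliqueSign (v ∷_) S) ⟩
    ∑ S (cliqueSign ∘ (v ∷_)) + e vs              ≡⟨ cong (_+ e vs) (∑-cong cliqueSign-∷ S) ⟩
    ∑ S (λ s → - when (all (adj v) s) (cliqueSign s)) + e vs
      ≡⟨ cong (_+ e vs) (trans (∑-neg _ S) (cong -_ (∑-sublists-all (adj v) cliqueSign vs))) ⟩
    - e (link v vs) + e vs                        ≡⟨ swap (e (link v vs)) (e vs) ⟩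
    e vs - e (link v vs) ∎
    where
    open ≡-Reasoning
    S = sublists vs
    swap : ∀ x y → - x + y ≡ y - x
    swap = solve-∀
    cliqueSign-∷ : ∀ s → cliqueSign (v ∷ s) ≡ - when (all (adj v) s) (cliqueSign s)
    cliqueSign-∷ s with all (adj v) s | isClique adj s
    ... | true  | true  = refl
    ... | true  | false = refl
    ... | false | _     = refl

  -- GDSSphere with χ replaced by e = 1 - χ, which is multiplicative under joins.
  Sphere : ℕ → List V → Set
  Sphere zero    vs = vs ≡ []
  Sphere (suc d) vs =
    (∃ λ v → v ∈ vs) × (∀ {v} → v ∈ vs → Sphere d (link v vs)) × e vs ≡ negOnePow (suc d)

  e-Sphere : ∀ d {vs} → Sphere d vs → e vs ≡ negOnePow d
  e-Sphere zero    refl        = refl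
  e-Sphere (suc d) (_ , _ , p) = p

  GDSManifold-intro : ∀ {d vs} → (∃ λ v → v ∈ vs) →
                      (∀ {v} → v ∈ vs → GDSSphere adj d (link v vs)) → GDSManifold adj d vs
  GDSManifold-intro {vs = _ ∷ _} _ links = All.tabulate links

  Sphere⇒GDSSphere : ∀ d {vs} → Sphere d vs → GDSSphere adj d vs
  Sphere⇒GDSSphere zero    refl = refl
  Sphere⇒GDSSphere (suc d) {vs} (v , links , p) =
    GDSManifold-intro v (Sphere⇒GDSSphere d ∘ links) ,
    trans (chiGraph≡1-e vs) (trans (cong (_-_ (+ 1)) p) (cong (_+_ (+ 1)) (neg-involutive (negOnePow d))))

  module _ {P : Pred V 0ℓ} (P? : Decidable P) where

    -- Adjacency is demanded in both orders because nothing in this module makes `adj` symmetric,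
    -- and links of vertices on either side are taken.
    Join : List V → Set
    Join vs = ∀ {u v} → u ∈ vs → v ∈ vs → P u → ¬ P v → T (adj u v) × T (adj v u)

    Join-filter : ∀ {Q : Pred V 0ℓ} (Q? : Decidable Q) {vs} → Join vs → Join (filter Q? vs)
    Join-filter Q? {vs} J u∈ v∈ = J (proj₁ (∈-filter⁻ Q? {xs = vs} u∈)) (proj₁ (∈-filter⁻ Q? {xs = vs} v∈))

    filter-link-¬P : ∀ {v vs} → (∀ {u} → u ∈ vs → ¬ P u → T (adj v u)) →
                     filter (¬? ∘ P?) (link v vs) ≡ filter (¬? ∘ P?) vs
    filter-link-¬P {v} {vs} J = trans (filter-comm (¬? ∘ P?) (T? ∘ adj v) vs)
      (filter-all-∈ (T? ∘ adj v) λ u∈ →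
        let u∈vs , ¬pu = ∈-filter⁻ (¬? ∘ P?) {xs = vs} u∈ in J u∈vs ¬pu)

    filter-link-P : ∀ {v vs} → (∀ {u} → u ∈ vs → P u → T (adj v u)) →
                    filter P? (link v vs) ≡ filter P? vs
    filter-link-P {v} {vs} J = trans (filter-comm P? (T? ∘ adj v) vs)
      (filter-all-∈ (T? ∘ adj v) λ u∈ →
        let u∈vs , pu = ∈-filter⁻ P? {xs = vs} u∈ in J u∈vs pu)

    -- Deleting `v` by `e-∷` leaves a difference of two joins. The link of `v` keeps the factor not
    -- containing `v` whole, so that factor can be pulled out, and `e-∷` read backwards reassembles
    -- the other one. The bound `m` on the length serves the recursive call on the link, which is
    -- not structural.
    e-join : ∀ m vs → length vs ℕ.≤ m → Join vs → e vs ≡ e (filter P? vs) * e (filter (¬? ∘ P?) vs)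
    e-join m [] _ J = refl
    e-join (suc m) (v ∷ vs) (ℕ.s≤s len) J = trans (e-∷ v vs) (trans (cong₂ _-_ ih ihN) step)
      where
      J′ : Join vs
      J′ u∈ w∈ = J (there u∈) (there w∈)
      N = link v vs
      ih = e-join m vs len J′
      ihN = e-join m N (ℕ.≤-trans (length-filter (T? ∘ adj v) vs) len) (Join-filter (T? ∘ adj v) {vs} J′)
      distribˡ : ∀ x y z → x * z - y * z ≡ (x - y) * z
      distribˡ = solve-∀
      distribʳ : ∀ x y z → x * y - x * z ≡ x * (y - z)
      distribʳ = solve-∀
      step : e (filter P? vs) * e (filter (¬? ∘ P?) vs) - e (filter P? N) * e (filter (¬? ∘ P?) N) ≡
             e (filter P? (v ∷ vs)) * e (filter (¬? ∘ P?) (v ∷ vs))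
      step with P? v
      ... | yes pv = begin
        eP * e¬P - e (filter P? N) * e (filter (¬? ∘ P?) N)
          ≡⟨ cong₂ (λ xs ys → eP * e¬P - e xs * e ys) (filter-comm P? (T? ∘ adj v) vs)
               (filter-link-¬P (λ u∈ → proj₁ ∘ J (here refl) (there u∈) pv)) ⟩
        eP * e¬P - e (link v (filter P? vs)) * e¬P   ≡⟨ distribˡ eP _ e¬P ⟩
        (eP - e (link v (filter P? vs))) * e¬P       ≡⟨ cong (_* e¬P) (sym (e-∷ v (filter P? vs))) ⟩
        e (v ∷ filter P? vs) * e¬P                   ∎
        where
        open ≡-Reasoning
        eP = e (filter P? vs)
        e¬P = e (filter (¬? ∘ P?) vs)
      ... | no ¬pv = begin
        eP * e¬P - e (filter P? N) * e (filter (¬? ∘ P?) N)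
          ≡⟨ cong₂ (λ xs ys → eP * e¬P - e xs * e ys)
               (filter-link-P (λ u∈ pu → proj₂ (J (there u∈) (here refl) pu ¬pv)))
               (filter-comm (¬? ∘ P?) (T? ∘ adj v) vs) ⟩
        eP * e¬P - eP * e (link v (filter (¬? ∘ P?) vs))   ≡⟨ distribʳ eP e¬P _ ⟩
        eP * (e¬P - e (link v (filter (¬? ∘ P?) vs)))      ≡⟨ cong (eP *_) (sym (e-∷ v (filter (¬? ∘ P?) vs))) ⟩
        eP * e (v ∷ filter (¬? ∘ P?) vs)                   ∎
        where
        open ≡-Reasoning
        eP = e (filter P? vs)
        e¬P = e (filter (¬? ∘ P?) vs)

    -- The link of a vertex of one factor is its link in that factor joined with the whole other
    -- factor. The total index therefore drops by one, whichever factor the vertex comes from, and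
    -- the recursion is on d.
    Sphere-join : ∀ d a b {vs} → a ℕ.+ b ≡ d → Join vs →
                  Sphere a (filter P? vs) → Sphere b (filter (¬? ∘ P?) vs) → Sphere d vs
    Sphere-join d a b {vs} a+b J SP S¬P = go d a b a+b SP S¬P
      where
      euler : ∀ {d} a b → a ℕ.+ b ≡ d → Sphere a (filter P? vs) → Sphere b (filter (¬? ∘ P?) vs) →
              e vs ≡ negOnePow d
      euler a b refl SP S¬P = trans (e-join _ vs ℕ.≤-refl J)
        (trans (cong₂ _*_ (e-Sphere a SP) (e-Sphere b S¬P)) (sym (sign-+ a b)))

      link-P : ∀ {d v} a b → suc d ≡ a ℕ.+ b → v ∈ vs → P v →
               Sphere a (filter P? vs) → Sphere b (filter (¬? ∘ P?) vs) → Sphere d (link v vs)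
      link-P zero b _ v∈ pv SP _ with () ← subst (_ ∈_) SP (∈-filter⁺ P? v∈ pv)
      link-P {d} {v} (suc a) b eq v∈ pv (_ , links , _) S¬P =
        Sphere-join d a b (sym (ℕ.suc-injective eq)) (Join-filter (T? ∘ adj v) {vs} J)
          (subst (Sphere a) (filter-comm (T? ∘ adj v) P? vs) (links (∈-filter⁺ P? v∈ pv)))
          (subst (Sphere b) (sym (filter-link-¬P λ u∈ → proj₁ ∘ J v∈ u∈ pv)) S¬P)

      link-¬P : ∀ {d v} a b → suc d ≡ a ℕ.+ b → v ∈ vs → ¬ P v →
                Sphere a (filter P? vs) → Sphere b (filter (¬? ∘ P?) vs) → Sphere d (link v vs)
      link-¬P a zero _ v∈ ¬pv _ S¬P with () ← subst (_ ∈_) S¬P (∈-filter⁺ (¬? ∘ P?) v∈ ¬pv)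
      link-¬P {d} {v} a (suc b) eq v∈ ¬pv SP (_ , links , _) =
        Sphere-join d a b (sym (ℕ.suc-injective (trans eq (ℕ.+-suc a b)))) (Join-filter (T? ∘ adj v) {vs} J)
          (subst (Sphere a) (sym (filter-link-P λ u∈ pu → proj₂ (J u∈ v∈ pu ¬pv))) SP)
          (subst (Sphere b) (filter-comm (T? ∘ adj v) (¬? ∘ P?) vs) (links (∈-filter⁺ (¬? ∘ P?) v∈ ¬pv)))

      vertex : ∀ a b {d} → a ℕ.+ b ≡ suc d → Sphere a (filter P? vs) → Sphere b (filter (¬? ∘ P?) vs) →
               ∃ λ v → v ∈ vs
      vertex zero (suc b) _ _ ((v , v∈) , _) = v , proj₁ (∈-filter⁻ (¬? ∘ P?) {xs = vs} v∈)
      vertex (suc a) b _ ((v , v∈) , _) _ = v , proj₁ (∈-filter⁻ P? {xs = vs} v∈)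

      go : ∀ d a b → a ℕ.+ b ≡ d → Sphere a (filter P? vs) → Sphere b (filter (¬? ∘ P?) vs) → Sphere d vs
      go zero zero zero _ SP S¬P = []-unique none
        where
        none : ∀ {v} → ¬ v ∈ vs
        none {v} v∈ with P? v
        ... | yes pv with () ← subst (v ∈_) SP (∈-filter⁺ P? v∈ pv)
        ... | no ¬pv with () ← subst (v ∈_) S¬P (∈-filter⁺ (¬? ∘ P?) v∈ ¬pv)
      go (suc d) a b a+b SP S¬P = vertex a b a+b SP S¬P , links , euler a b a+b SP S¬P
        where
        links : ∀ {v} → v ∈ vs → Sphere d (link v vs)
        links {v} v∈ with P? v
        ... | yes pv = link-P a b (sym a+b) v∈ pv SP S¬P
        ... | no ¬pv = link-¬P a b (sym a+b) v∈ ¬pv SP S¬P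

-- Posets of subsets

_≟ˢ_ : ∀ {n} (x y : Subset n) → Dec (x ≡ y)
_≟ˢ_ = ≡-dec Bool._≟_

⊆∧≢⇒⊂ : ∀ {n} {x y : Subset n} → x ⊆ y → x ≢ y → x ⊂ y
⊆∧≢⇒⊂ {x = []} {[]} x⊆y x≢y = contradiction refl x≢y
⊆∧≢⇒⊂ {x = true ∷ x} {true ∷ y} x⊆y x≢y = in⊂in (⊆∧≢⇒⊂ (drop-∷-⊆ x⊆y) (x≢y ∘ cong (true ∷_)))
⊆∧≢⇒⊂ {x = true ∷ x} {false ∷ y} x⊆y x≢y with () ← x⊆y here
⊆∧≢⇒⊂ {x = false ∷ x} {true ∷ y} x⊆y x≢y = out⊂in (drop-∷-⊆ x⊆y)
⊆∧≢⇒⊂ {x = false ∷ x} {false ∷ y} x⊆y x≢y = out⊂ (⊆∧≢⇒⊂ (drop-∷-⊆ x⊆y) (x≢y ∘ cong (false ∷_)))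

containAdj⁺ : ∀ {n} {x y : Subset n} → x ⊂ y → T (containAdj x y) × T (containAdj y x)
containAdj⁺ {x = x} {y} x⊂y with x ≟ˢ y | y ≟ˢ x | x ⊆? y
... | yes refl | _        | _       = contradiction x⊂y (⊂-irref refl)
... | _        | yes refl | _       = contradiction x⊂y (⊂-irref refl)
... | _        | _        | no x⊈y  = ⊥-elim (x⊈y (proj₁ x⊂y))
... | no _     | no _     | yes _ with y ⊆? x
...   | yes _ = _
...   | no _  = _

containAdj⁻ : ∀ {n} {x y : Subset n} → T (containAdj x y) → x ⊂ y ⊎ y ⊂ x
containAdj⁻ {x = x} {y} adj with x ≟ˢ y | x ⊆? y | y ⊆? x
... | no x≢y | yes x⊆y | _ = inj₁ (⊆∧≢⇒⊂ x⊆y x≢y)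
... | no x≢y | no _    | yes y⊆x = inj₂ (⊆∧≢⇒⊂ y⊆x (x≢y ∘ sym))

subsets-complete : ∀ {n} (x : Subset n) → x ∈ subsets n
subsets-complete [] = here refl
subsets-complete (true ∷ x) = ∈-++⁺ˡ (∈-map⁺ (true ∷_) (subsets-complete x))
subsets-complete {suc n} (false ∷ x) =
  ∈-++⁺ʳ (map (true ∷_) (subsets n)) (∈-map⁺ (false ∷_) (subsets-complete x))

-- At each coordinate the sets containing it are listed before those avoiding it, so `subsets` is a
-- linear extension of reverse inclusion. This is the order in which `e-chains` removes vertices.
subsets-⊄ : ∀ n → AllPairs _⊄_ (subsets n)
subsets-⊄ zero = [] ∷ []
subsets-⊄ (suc n) = AllPairs.++⁺
  (AllPairs.map⁺ (AllPairs.map (λ x⊄y → x⊄y ∘ drop-∷-⊂) (subsets-⊄ n)))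
  (AllPairs.map⁺ (AllPairs.map (λ x⊄y → x⊄y ∘ drop-∷-⊂) (subsets-⊄ n)))
  (All.map⁺ (All.universal (λ x → All.map⁺ (All.universal (λ y → in⊄out) (subsets n))) (subsets n)))
  where
  in⊄out : ∀ {x y : Subset n} → (true ∷ x) ⊄ (false ∷ y)
  in⊄out (x⊆y , _) with () ← x⊆y here

-- The clique sum of a poset of sets is grouped by the top of each chain.
e-chains : ∀ {n} {vs : List (Subset n)} → AllPairs _⊄_ vs →
           e containAdj vs ≡ + 1 - ∑ vs (λ v → e containAdj (filter (_⊂? v) vs))
e-chains [] = refl
e-chains {vs = u ∷ vs} (u⊄ ∷ ⊄s) = begin
  e containAdj (u ∷ vs)
    ≡⟨ e-∷ containAdj u vs ⟩
  e containAdj vs - e containAdj (link containAdj u vs)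
    ≡⟨ cong₂ (λ x ys → x - e containAdj ys) (e-chains ⊄s) below ⟩
  + 1 - ∑ vs (λ v → e containAdj (filter (_⊂? v) vs)) - e containAdj (filter (_⊂? u) (u ∷ vs))
    ≡⟨ cong (λ x → + 1 - x - e containAdj (filter (_⊂? u) (u ∷ vs)))
         (∑-cong-All (All.map (λ {v} u⊄v → cong (e containAdj) (sym (filter-reject (_⊂? v) u⊄v))) u⊄)) ⟩
  + 1 - ∑ vs (λ v → e containAdj (filter (_⊂? v) (u ∷ vs))) - e containAdj (filter (_⊂? u) (u ∷ vs))
    ≡⟨ regroup (∑ vs (λ v → e containAdj (filter (_⊂? v) (u ∷ vs)))) (e containAdj (filter (_⊂? u) (u ∷ vs))) ⟩
  + 1 - (e containAdj (filter (_⊂? u) (u ∷ vs)) + ∑ vs (λ v → e containAdj (filter (_⊂? v) (u ∷ vs)))) ∎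
  where
  open ≡-Reasoning
  regroup : ∀ x y → + 1 - x - y ≡ + 1 - (y + x)
  regroup = solve-∀
  -- By the order of the list nothing in `vs` lies strictly above `u`, so every neighbour of `u`
  -- still present is below it.
  below : link containAdj u vs ≡ filter (_⊂? u) (u ∷ vs)
  below = trans
    (filter-cong-∈ (T? ∘ containAdj u) (_⊂? u)
      (λ v∈ adj → [ (λ u⊂v → contradiction u⊂v (All.lookup u⊄ v∈)) , id ] (containAdj⁻ adj))
      (λ _ v⊂u → proj₂ (containAdj⁺ v⊂u)))
    (sym (filter-reject (_⊂? u) (⊂-irref refl)))

-- This is -ω on non-empty sets. The empty set gets the value 1, which lets sums over whole Boolean
-- intervals cancel.
sgn : ∀ {n} → Subset n → ℤ
sgn x = negOnePow ∣ x ∣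

module _ {n : ℕ} where

  poset : {P : Pred (Subset n) 0ℓ} → Decidable P → List (Subset n)
  poset P? = filter P? (subsets n)

  ∈-poset⁺ : ∀ {P : Pred (Subset n) 0ℓ} (P? : Decidable P) {v} → P v → v ∈ poset P?
  ∈-poset⁺ P? {v} pv = ∈-filter⁺ P? (subsets-complete v) pv

  ∈-poset⁻ : ∀ {P : Pred (Subset n) 0ℓ} (P? : Decidable P) {v} → v ∈ poset P? → P v
  ∈-poset⁻ P? v∈ = proj₂ (∈-filter⁻ P? {xs = subsets n} v∈)

  poset-cong : ∀ {P Q : Pred (Subset n) 0ℓ} (P? : Decidable P) (Q? : Decidable Q) →
               (∀ {v} → P v → Q v) → (∀ {v} → Q v → P v) → poset P? ≡ poset Q?
  poset-cong P? Q? P⇒Q Q⇒P = filter-≐ P? Q? (P⇒Q , Q⇒P) (subsets n)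

  signSum : {P : Pred (Subset n) 0ℓ} → Decidable P → ℤ
  signSum P? = ∑ (subsets n) (λ v → when (does (P? v)) (sgn v))

  below? : {P : Pred (Subset n) 0ℓ} → Decidable P → ∀ v → Decidable (λ u → P u × u ⊂ v)
  below? P? v u = P? u ×-dec u ⊂? v

  above? : {P : Pred (Subset n) 0ℓ} → Decidable P → ∀ v → Decidable (λ u → P u × v ⊂ u)
  above? P? v u = P? u ×-dec v ⊂? u

  -- Turns Euler characteristics into alternating sums. The assumption on lower parts is what
  -- induction yields: below `v` there is a sphere of index |v| minus a constant, and `c` is the
  -- sign of that constant.
  e-poset : ∀ {P : Pred (Subset n) 0ℓ} (P? : Decidable P) c →
            (∀ v → P v → e containAdj (poset (below? P? v)) ≡ c * sgn v) →
            e containAdj (poset P?) ≡ + 1 - c * signSum P?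
  e-poset P? c lower = trans (e-chains (AllPairs.filter⁺ P? (subsets-⊄ n))) (cong (_-_ (+ 1)) (begin
    ∑ (poset P?) (λ v → e containAdj (filter (_⊂? v) (poset P?)))
      ≡⟨ ∑-filter P? _ (subsets n) ⟩
    ∑ (subsets n) (λ v → when (does (P? v)) (e containAdj (filter (_⊂? v) (poset P?))))
      ≡⟨ ∑-cong term (subsets n) ⟩
    ∑ (subsets n) (λ v → c * when (does (P? v)) (sgn v))
      ≡⟨ ∑-*ˡ c _ (subsets n) ⟩
    c * signSum P? ∎))
    where
    open ≡-Reasoning
    *-zero : ∀ z → + 0 ≡ z * + 0
    *-zero = solve-∀
    term : ∀ v → when (does (P? v)) (e containAdj (filter (_⊂? v) (poset P?))) ≡
                 c * when (does (P? v)) (sgn v)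
    term v with P? v
    ... | no _   = *-zero c
    ... | yes pv = trans
      (cong (e containAdj)
        (filter-filter (_⊂? v) P? (below? P? v) (λ u⊂v pu → pu , u⊂v) (λ (pu , u⊂v) → u⊂v , pu) (subsets n)))
      (lower v pv)

  -- Comparability splits the unit sphere of v into the join of its lower and upper part.
  link-Sphere : ∀ {P : Pred (Subset n) 0ℓ} (P? : Decidable P) {v} a b {d} → a ℕ.+ b ≡ d →
                Sphere containAdj a (poset (below? P? v)) → Sphere containAdj b (poset (above? P? v)) →
                Sphere containAdj d (link containAdj v (poset P?))
  link-Sphere P? {v} a b a+b S↓ S↑ =
    Sphere-join containAdj (_⊂? v) _ a b a+b cross
      (subst (Sphere containAdj a) (sym lower) S↓) (subst (Sphere containAdj b) (sym upper) S↑)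
    where
    link? = λ u → T? (containAdj v u) ×-dec P? u
    link-poset : link containAdj v (poset P?) ≡ poset link?
    link-poset = filter-filter (T? ∘ containAdj v) P? link? _,_ id (subsets n)
    above : ∀ {u} → T (containAdj v u) → ¬ u ⊂ v → v ⊂ u
    above adj u⊄v with containAdj⁻ adj
    ... | inj₁ v⊂u = v⊂u
    ... | inj₂ u⊂v = contradiction u⊂v u⊄v
    lower = trans (cong (filter (_⊂? v)) link-poset)
      (filter-filter (_⊂? v) link? (below? P? v) (λ u⊂v (_ , pu) → pu , u⊂v)
        (λ (pu , u⊂v) → u⊂v , proj₂ (containAdj⁺ u⊂v) , pu) (subsets n))
    upper = trans (cong (filter (¬? ∘ (_⊂? v))) link-poset)
      (filter-filter (¬? ∘ (_⊂? v)) link? (above? P? v) (λ u⊄v (adj , pu) → pu , above adj u⊄v)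
        (λ (pu , v⊂u) → ⊂-asymmetric v⊂u , proj₁ (containAdj⁺ v⊂u) , pu) (subsets n))
    cross : Join containAdj (_⊂? v) (link containAdj v (poset P?))
    cross {u} {w} _ w∈ u⊂v w⊄v = containAdj⁺ (⊂-trans u⊂v
      (above (proj₁ (∈-poset⁻ link? {w} (subst (w ∈_) link-poset w∈))) w⊄v))

  -- The induction step shared by the three families of posets: open intervals, fully coloured lower
  -- parts, and upper parts in the complex.
  Sphere-suc : ∀ {P : Pred (Subset n) 0ℓ} (P? : Decidable P) d → ∃ P →
               e containAdj (poset P?) ≡ negOnePow (suc d) →
               (∀ v → P v → ∃₂ λ a b → a ℕ.+ b ≡ d ×
                 Sphere containAdj a (poset (below? P? v)) × Sphere containAdj b (poset (above? P? v))) →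
               Sphere containAdj (suc d) (poset P?)
  Sphere-suc P? d (v , pv) euler links =
    (v , ∈-poset⁺ P? pv) ,
    (λ {u} u∈ → let a , b , a+b , S↓ , S↑ = links u (∈-poset⁻ P? u∈) in link-Sphere P? a b a+b S↓ S↑) ,
    euler

  Sphere-zero : ∀ {P : Pred (Subset n) 0ℓ} (P? : Decidable P) → (∀ v → ¬ P v) → Sphere containAdj 0 (poset P?)
  Sphere-zero P? none = []-unique λ {v} v∈ → none v (∈-poset⁻ P? v∈)

-- Alternating sums over subsets

∑-subsets-suc : ∀ {n} (f : Subset (suc n) → ℤ) →
  ∑ (subsets (suc n)) f ≡ ∑ (subsets n) (f ∘ (true ∷_)) + ∑ (subsets n) (f ∘ (false ∷_))
∑-subsets-suc {n} f = trans (∑-++ f (map (true ∷_) (subsets n)) (map (false ∷_) (subsets n)))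
  (cong₂ _+_ (∑-map f (true ∷_) (subsets n)) (∑-map f (false ∷_) (subsets n)))

-- Each subset occurs exactly once in `subsets n`, so altering the summand at `x` alone changes the
-- sum by exactly that amount.
∑-subsets-remove : ∀ {n} (x : Subset n) (f g : Subset n → ℤ) → g x ≡ + 0 →
  (∀ v → v ≢ x → f v ≡ g v) → ∑ (subsets n) f ≡ f x + ∑ (subsets n) g
∑-subsets-remove [] f g gx eq = cong (λ z → f [] + (z + + 0)) (sym gx)
∑-subsets-remove {suc n} (true ∷ x) f g gx eq = begin
  ∑ (subsets (suc n)) f
    ≡⟨ ∑-subsets-suc f ⟩
  ∑ (subsets n) (f ∘ (true ∷_)) + ∑ (subsets n) (f ∘ (false ∷_))
    ≡⟨ cong₂ _+_ (∑-subsets-remove x (f ∘ (true ∷_)) (g ∘ (true ∷_)) gx λ v v≢x → eq _ λ { refl → v≢x refl })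
                 (∑-cong (λ v → eq (false ∷ v) λ ()) (subsets n)) ⟩
  f (true ∷ x) + ∑ (subsets n) (g ∘ (true ∷_)) + ∑ (subsets n) (g ∘ (false ∷_))
    ≡⟨ assoc (f (true ∷ x)) _ _ ⟩
  f (true ∷ x) + (∑ (subsets n) (g ∘ (true ∷_)) + ∑ (subsets n) (g ∘ (false ∷_)))
    ≡⟨ cong (_+_ (f (true ∷ x))) (sym (∑-subsets-suc g)) ⟩
  f (true ∷ x) + ∑ (subsets (suc n)) g ∎
  where
  open ≡-Reasoning
  assoc : ∀ a b c → a + b + c ≡ a + (b + c)
  assoc = solve-∀
∑-subsets-remove {suc n} (false ∷ x) f g gx eq = begin
  ∑ (subsets (suc n)) f
    ≡⟨ ∑-subsets-suc f ⟩
  ∑ (subsets n) (f ∘ (true ∷_)) + ∑ (subsets n) (f ∘ (false ∷_))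
    ≡⟨ cong₂ _+_ (∑-cong (λ v → eq (true ∷ v) λ ()) (subsets n))
                 (∑-subsets-remove x (f ∘ (false ∷_)) (g ∘ (false ∷_)) gx λ v v≢x → eq _ λ { refl → v≢x refl }) ⟩
  ∑ (subsets n) (g ∘ (true ∷_)) + (f (false ∷ x) + ∑ (subsets n) (g ∘ (false ∷_)))
    ≡⟨ left-comm (f (false ∷ x)) (∑ (subsets n) (g ∘ (true ∷_))) _ ⟩
  f (false ∷ x) + (∑ (subsets n) (g ∘ (true ∷_)) + ∑ (subsets n) (g ∘ (false ∷_)))
    ≡⟨ cong (_+_ (f (false ∷ x))) (sym (∑-subsets-suc g)) ⟩
  f (false ∷ x) + ∑ (subsets (suc n)) g ∎
  where
  open ≡-Reasoning
  left-comm : ∀ a b c → b + (a + c) ≡ a + (b + c)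
  left-comm = solve-∀

module _ {n : ℕ} {P Q : Pred (Subset n) 0ℓ} (P? : Decidable P) (Q? : Decidable Q) where

  signSum-cong : (∀ {v} → P v → Q v) → (∀ {v} → Q v → P v) → signSum P? ≡ signSum Q?
  signSum-cong P⇒Q Q⇒P = ∑-cong term (subsets n)
    where
    term : ∀ v → when (does (P? v)) (sgn v) ≡ when (does (Q? v)) (sgn v)
    term v with P? v | Q? v
    ... | yes _ | yes _ = refl
    ... | no _  | no _  = refl
    ... | yes p | no ¬q = contradiction (P⇒Q p) ¬q
    ... | no ¬p | yes q = contradiction (Q⇒P q) ¬p

  signSum-remove : ∀ x → P x → ¬ Q x → (∀ {v} → P v → v ≢ x → Q v) → (∀ {v} → Q v → P v) →
                   signSum P? ≡ sgn x + signSum Q?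
  signSum-remove x px ¬qx P⇒Q Q⇒P =
    trans (∑-subsets-remove x _ _ Qx agree) (cong (_+ signSum Q?) Px)
    where
    Px : when (does (P? x)) (sgn x) ≡ sgn x
    Px with P? x
    ... | yes _ = refl
    ... | no ¬p = contradiction px ¬p
    Qx : when (does (Q? x)) (sgn x) ≡ + 0
    Qx with Q? x
    ... | yes q = contradiction q ¬qx
    ... | no _  = refl
    agree : ∀ v → v ≢ x → when (does (P? v)) (sgn v) ≡ when (does (Q? v)) (sgn v)
    agree v v≢x with P? v | Q? v
    ... | yes _ | yes _ = refl
    ... | no _  | no _  = refl
    ... | yes p | no ¬q = contradiction (P⇒Q p v≢x) ¬q
    ... | no ¬p | yes q = contradiction (Q⇒P q) ¬p

signSum-suc : ∀ {n} {P : Pred (Subset (suc n)) 0ℓ} (P? : Decidable P) →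
              signSum P? ≡ - signSum (P? ∘ (true ∷_)) + signSum (P? ∘ (false ∷_))
signSum-suc {n} P? = trans (∑-subsets-suc (λ z → when (does (P? z)) (sgn z)))
  (cong (_+ signSum (P? ∘ (false ∷_))) (trans (∑-cong neg (subsets n)) (∑-neg _ (subsets n))))
  where
  neg : ∀ z → when (does (P? (true ∷ z))) (- sgn z) ≡ - when (does (P? (true ∷ z))) (sgn z)
  neg z with does (P? (true ∷ z))
  ... | true  = refl
  ... | false = refl

signSum-[] : {P : Pred (Subset 0) 0ℓ} (P? : Decidable P) → P [] → signSum P? ≡ + 1
signSum-[] P? p with P? []
... | yes _ = refl
... | no ¬p = contradiction p ¬p

AgreeOff : ∀ {n} → Fin n → Subset n → Subset n → Set
AgreeOff i z z′ = ∀ {j} → i ≢ j → lookup z j ≡ lookup z′ j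

AgreeOff-∈ : ∀ {n} {i j : Fin n} {z z′ : Subset n} → AgreeOff i z z′ → i ≢ j → j ∈ˢ z → j ∈ˢ z′
AgreeOff-∈ {j = j} {z} {z′} agree i≢j j∈z = lookup⇒[]= j z′ (trans (sym (agree i≢j)) ([]=⇒lookup j∈z))

-- Switching the membership of `i` is a sign-reversing involution without fixed points on the sets
-- satisfying `P`. The recursion walks to coordinate `i`, where the two halves of `signSum-suc`
-- cancel.
signSum-toggle : ∀ {n} (i : Fin n) {P : Pred (Subset n) 0ℓ} (P? : Decidable P) →
                 (∀ {z z′} → AgreeOff i z z′ → P z → P z′) → signSum P? ≡ + 0
signSum-toggle {suc n} zero P? inv = trans (signSum-suc P?)
  (trans (cong (λ z → - z + signSum (P? ∘ (false ∷_)))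
           (signSum-cong (P? ∘ (true ∷_)) (P? ∘ (false ∷_)) (inv agree) (inv agree)))
         (cancel (signSum (P? ∘ (false ∷_)))))
  where
  cancel : ∀ z → - z + z ≡ + 0
  cancel = solve-∀
  agree : ∀ {b c} {z : Subset n} → AgreeOff zero (b ∷ z) (c ∷ z)
  agree {j = zero} 0≢0 = contradiction refl 0≢0
  agree {j = suc j} _ = refl
signSum-toggle {suc n} (suc i) P? inv =
  trans (signSum-suc P?) (cong₂ (λ y z → - y + z) (half true) (half false))
  where
  half : ∀ b → signSum (λ z → P? (b ∷ z)) ≡ + 0
  half b = signSum-toggle i (λ z → P? (b ∷ z)) λ {z} {z′} agree →
    inv λ { {zero} _ → refl ; {suc j} i≢j → agree (i≢j ∘ cong suc) }

signSum-none : ∀ {n} {P : Pred (Subset n) 0ℓ} (P? : Decidable P) → (∀ {v} → ¬ P v) → signSum P? ≡ + 0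
signSum-none {n} P? none = trans (∑-cong term (subsets n)) (∑-zero (subsets n))
  where
  term : ∀ v → when (does (P? v)) (sgn v) ≡ + 0
  term v with P? v
  ... | yes p = contradiction p none
  ... | no _  = refl

signSum-split : ∀ {n} {P Q R : Pred (Subset n) 0ℓ} (P? : Decidable P) (Q? : Decidable Q) (R? : Decidable R) →
  (∀ {v} → P v → Q v ⊎ R v) → (∀ {v} → Q v → P v) → (∀ {v} → R v → P v) → (∀ {v} → Q v → ¬ R v) →
  signSum P? ≡ signSum Q? + signSum R?
signSum-split {n} P? Q? R? P⇒Q⊎R Q⇒P R⇒P disjoint = trans (∑-cong term (subsets n)) (∑-+ _ _ (subsets n))
  where
  term : ∀ v → when (does (P? v)) (sgn v) ≡
               when (does (Q? v)) (sgn v) + when (does (R? v)) (sgn v)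
  term v with Q? v | R? v | P? v
  ... | yes q | yes r | _     = contradiction r (disjoint q)
  ... | yes q | no _  | yes _ = sym (+-identityʳ _)
  ... | yes q | no _  | no ¬p = contradiction (Q⇒P q) ¬p
  ... | no _  | yes r | yes _ = sym (+-identityˡ _)
  ... | no _  | yes r | no ¬p = contradiction (R⇒P r) ¬p
  ... | no _  | no _  | no _  = refl
  ... | no ¬q | no ¬r | yes p with P⇒Q⊎R p
  ...   | inj₁ q = contradiction q ¬q
  ...   | inj₂ r = contradiction r ¬r

-- Open intervals

<⇒∃ : ∀ {m n} → m ℕ.< n → ∃ λ d → n ≡ suc (m ℕ.+ d)
<⇒∃ m<n = let d , eq = ℕ.m≤n⇒∃[o]m+o≡n m<n in d , sym eq

between? : ∀ {n} (x y : Subset n) → Decidable (λ v → x ⊂ v × v ⊂ y)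
between? x y v = x ⊂? v ×-dec v ⊂? y

-- The closed interval from `x` to `y` sums to 0 by toggling an element `i` of `y` outside `x`;
-- taking away the two ends leaves minus their signs.
signSum-between : ∀ {n} {x y : Subset n} → x ⊂ y → signSum (between? x y) ≡ - (sgn x + sgn y)
signSum-between {x = x} {y} x⊂y@(x⊆y , i , i∈y , i∉x) =
  solveFor (sgn x) (sgn y) (signSum (between? x y)) (begin
    sgn y + (sgn x + signSum (between? x y))
      ≡⟨ cong (_+_ (sgn y)) (sym (signSum-remove half? (between? x y) x (⊆-refl , x⊂y)
           (⊂-irref refl ∘ proj₁) (λ (x⊆v , v⊂y) v≢x → ⊆∧≢⇒⊂ x⊆v (v≢x ∘ sym) , v⊂y)
           (λ (x⊂v , v⊂y) → proj₁ x⊂v , v⊂y))) ⟩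
    sgn y + signSum half?
      ≡⟨ sym (signSum-remove closed? half? y (x⊆y , ⊆-refl)
           (⊂-irref refl ∘ proj₂) (λ (x⊆v , v⊆y) v≢y → x⊆v , ⊆∧≢⇒⊂ v⊆y v≢y) (λ (x⊆v , v⊂y) → x⊆v , proj₁ v⊂y)) ⟩
    signSum closed?
      ≡⟨ signSum-toggle i closed? toggle ⟩
    + 0 ∎)
  where
  open ≡-Reasoning
  closed? = λ v → x ⊆? v ×-dec v ⊆? y
  half? = λ v → x ⊆? v ×-dec v ⊂? y
  solveFor : ∀ a b z → b + (a + z) ≡ + 0 → z ≡ - (a + b)
  solveFor a b z eq = trans (+-isolate a z (+-isolate b (a + z) eq)) (collect a b)
    where
    collect : ∀ a b → + 0 - b - a ≡ - (a + b)
    collect = solve-∀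
  toggle : ∀ {z z′} → AgreeOff i z z′ → x ⊆ z × z ⊆ y → x ⊆ z′ × z′ ⊆ y
  toggle {z} {z′} agree (x⊆z , z⊆y) =
    (λ j∈x → AgreeOff-∈ {z = z} agree (λ { refl → i∉x j∈x }) (x⊆z j∈x)) , z′⊆y
    where
    z′⊆y : z′ ⊆ y
    z′⊆y {j} j∈z′ with i Fin.≟ j
    ... | yes refl = i∈y
    ... | no i≢j   = z⊆y (AgreeOff-∈ {z = z′} (sym ∘ agree) i≢j j∈z′)

insert-⊂ : ∀ {n} {x y : Subset n} → x ⊂ y → ∃ λ v → x ⊂ v × v ⊆ y × ∣ v ∣ ≡ suc ∣ x ∣
insert-⊂ {x = true ∷ x} {false ∷ y} (x⊆y , _) with () ← x⊆y here
insert-⊂ {x = false ∷ x} {true ∷ y} (x⊆y , _) = true ∷ x , out⊂in ⊆-refl , in⊆in (drop-∷-⊆ x⊆y) , refl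
insert-⊂ {x = true ∷ x} {true ∷ y} x⊂y =
  let v , x⊂v , v⊆y , eq = insert-⊂ (drop-∷-⊂ x⊂y) in true ∷ v , in⊂in x⊂v , in⊆in v⊆y , cong suc eq
insert-⊂ {x = false ∷ x} {false ∷ y} x⊂y =
  let v , x⊂v , v⊆y , eq = insert-⊂ (drop-∷-⊂ x⊂y) in false ∷ v , out⊂ x⊂v , out⊆ v⊆y , eq

-- This poset is the barycentric subdivision of the boundary of the simplex on the d + 1 elements of
-- `y` outside `x`, hence a (d - 1)-sphere. A vertex `v` splits it into two shorter intervals of
-- arbitrary lengths, so `go` is a strong induction with bound `m`.
interval-Sphere : ∀ {n} {x y : Subset n} d → x ⊂ y → ∣ y ∣ ≡ suc (∣ x ∣ ℕ.+ d) →
                  Sphere containAdj d (poset (between? x y))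
interval-Sphere {n} d = go (suc d) d ℕ.≤-refl
  where
  go : ∀ m d {x y : Subset n} → d ℕ.< m → x ⊂ y → ∣ y ∣ ≡ suc (∣ x ∣ ℕ.+ d) →
       Sphere containAdj d (poset (between? x y))
  go (suc m) zero {x} {y} _ x⊂y size = Sphere-zero (between? x y) λ v (x⊂v , v⊂y) →
    ℕ.<-irrefl (trans (cong suc (sym (ℕ.+-identityʳ ∣ x ∣))) (sym size))
      (ℕ.≤-<-trans (p⊂q⇒∣p∣<∣q∣ x⊂v) (p⊂q⇒∣p∣<∣q∣ v⊂y))
  go (suc m) (suc d) {x} {y} (ℕ.s≤s d<m) x⊂y size = Sphere-suc (between? x y) d inhabited euler links
    where
    inhabited : ∃ λ v → x ⊂ v × v ⊂ y
    inhabited with insert-⊂ x⊂y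
    ... | v , x⊂v , v⊆y , eq = v , x⊂v , ⊆∧≢⇒⊂ v⊆y λ { refl →
      ℕ.m≢1+m+n ∣ x ∣ {d} (trans (ℕ.suc-injective (trans (sym eq) size)) (ℕ.+-suc ∣ x ∣ d)) }
    parts : ∀ v → x ⊂ v → v ⊂ y → ∃₂ λ a b → a ℕ.+ b ≡ d × ∣ v ∣ ≡ suc (∣ x ∣ ℕ.+ a) × ∣ y ∣ ≡ suc (∣ v ∣ ℕ.+ b)
    parts v x⊂v v⊂y with <⇒∃ (p⊂q⇒∣p∣<∣q∣ x⊂v) | <⇒∃ (p⊂q⇒∣p∣<∣q∣ v⊂y)
    ... | a , eqv | b , eqy = a , b , ℕ.suc-injective (ℕ.+-cancelˡ-≡ ∣ x ∣ _ _ (ℕ.suc-injective (begin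
      suc (∣ x ∣ ℕ.+ suc (a ℕ.+ b))     ≡⟨ cong suc (ℕ.+-suc ∣ x ∣ (a ℕ.+ b)) ⟩
      suc (suc (∣ x ∣ ℕ.+ (a ℕ.+ b)))   ≡⟨ cong (2 ℕ.+_) (sym (ℕ.+-assoc ∣ x ∣ a b)) ⟩
      suc (suc (∣ x ∣ ℕ.+ a) ℕ.+ b)     ≡⟨ cong (λ s → suc (s ℕ.+ b)) (sym eqv) ⟩
      suc (∣ v ∣ ℕ.+ b)                 ≡⟨ trans (sym eqy) size ⟩
      suc (∣ x ∣ ℕ.+ suc d)             ∎))) , eqv , eqy
      where open ≡-Reasoning
    lower : ∀ v → x ⊂ v → v ⊂ y → ∃₂ λ a b → a ℕ.+ b ≡ d ×
            ∣ v ∣ ≡ suc (∣ x ∣ ℕ.+ a) × ∣ y ∣ ≡ suc (∣ v ∣ ℕ.+ b) ×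
            Sphere containAdj a (poset (below? (between? x y) v))
    lower v x⊂v v⊂y with parts v x⊂v v⊂y
    ... | a , b , a+b , eqv , eqy = a , b , a+b , eqv , eqy ,
      subst (Sphere containAdj a)
        (poset-cong (between? x v) (below? (between? x y) v)
          (λ (x⊂u , u⊂v) → (x⊂u , ⊂-trans u⊂v v⊂y) , u⊂v) (λ ((x⊂u , _) , u⊂v) → x⊂u , u⊂v))
        (go m a (ℕ.≤-<-trans (ℕ.m+n≤o⇒m≤o a (ℕ.≤-reflexive a+b)) d<m) x⊂v eqv)
    links : ∀ v → x ⊂ v × v ⊂ y → ∃₂ λ a b → a ℕ.+ b ≡ d ×
            Sphere containAdj a (poset (below? (between? x y) v)) ×
            Sphere containAdj b (poset (above? (between? x y) v))
    links v (x⊂v , v⊂y) with lower v x⊂v v⊂y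
    ... | a , b , a+b , eqv , eqy , S↓ = a , b , a+b , S↓ ,
      subst (Sphere containAdj b)
        (poset-cong (between? v y) (above? (between? x y) v)
          (λ (v⊂u , u⊂y) → (⊂-trans x⊂v v⊂u , u⊂y) , v⊂u) (λ ((_ , u⊂y) , v⊂u) → v⊂u , u⊂y))
        (go m b (ℕ.≤-<-trans (ℕ.m+n≤o⇒n≤o a (ℕ.≤-reflexive a+b)) d<m) v⊂y eqy)
    euler : e containAdj (poset (between? x y)) ≡ negOnePow (suc d)
    euler = begin
      e containAdj (poset (between? x y))
        -- The part below `v` has index a = |v| - |x| - 1, so (-1)^a is `- sgn x * sgn v`.
        ≡⟨ e-poset (between? x y) (- s) (λ v (x⊂v , v⊂y) → let a , _ , _ , eqv , _ , S↓ = lower v x⊂v v⊂y in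
             trans (e-Sphere containAdj a S↓) (trans (sym (sign-absorb-suc ∣ x ∣ a))
                 (cong (λ z → - s * negOnePow z) (sym eqv)))) ⟩
      + 1 - - s * signSum (between? x y)
        ≡⟨ cong (λ z → + 1 - - s * z) (signSum-between x⊂y) ⟩
      + 1 - - s * - (s + sgn y)
        ≡⟨ expand s (sgn y) ⟩
      + 1 - s * s + - s * sgn y
        ≡⟨ cong (λ z → + 1 - z + - s * sgn y) (sign-square ∣ x ∣) ⟩
      + 0 + - s * sgn y
        ≡⟨ +-identityˡ _ ⟩
      - s * sgn y
        ≡⟨ trans (cong (λ z → - s * negOnePow z) size) (sign-absorb-suc ∣ x ∣ (suc d)) ⟩
      negOnePow (suc d) ∎
      where
      open ≡-Reasoning
      s = sgn x
      expand : ∀ s t → + 1 - - s * - (s + t) ≡ + 1 - s * s + - s * t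
      expand = solve-∀

-- Colourings

∣∖∣ : ∀ {n} {p : Subset n} {i} → i ∈ˢ p → ∣ p ∣ ≡ suc ∣ p ∖ i ∣
∣∖∣ {p = true ∷ p} here = cong (suc ∘ ∣_∣) (sym (p─⊥≡p p))
∣∖∣ {p = true ∷ p} (there i∈p) = cong suc (∣∖∣ i∈p)
∣∖∣ {p = false ∷ p} (there i∈p) = ∣∖∣ i∈p

i∉p∖i : ∀ {n} (p : Subset n) i → i ∉ˢ p ∖ i
i∉p∖i (_ ∷ p) zero ()
i∉p∖i (_ ∷ p) (suc i) (there i∈) = i∉p∖i p i i∈

module _ {m : ℕ} where

  -- The demanded colours form an arbitrary set `R` so that induction over the vertices is possible:
  -- once the first vertex is taken, only the colours in `R ∖ g zero` are still demanded of the
  -- others.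
  Covers : ∀ {n} → (Fin n → Fin m) → Subset m → Subset n → Set
  Covers g R x = ∀ c → c ∈ˢ R → ∃ λ i → i ∈ˢ x × g i ≡ c

  covers? : ∀ {n} (g : Fin n → Fin m) R → Decidable (Covers g R)
  covers? g R x = Fin.all? λ c → (c ∈? R) →-dec Fin.any? λ i → (i ∈? x) ×-dec (g i Fin.≟ c)

  Covers-mono : ∀ {n} {g : Fin n → Fin m} {R} {x y : Subset n} → x ⊆ y → Covers g R x → Covers g R y
  Covers-mono x⊆y cov c c∈R = let i , i∈x , eq = cov c c∈R in i , x⊆y i∈x , eq

  module _ {n} {g : Fin (suc n) → Fin m} {R : Subset m} {x : Subset n} where

    Covers-out⁺ : Covers (g ∘ suc) R x → Covers g R (false ∷ x)
    Covers-out⁺ cov c c∈R = let i , i∈x , eq = cov c c∈R in suc i , there i∈x , eq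

    Covers-out⁻ : Covers g R (false ∷ x) → Covers (g ∘ suc) R x
    Covers-out⁻ cov c c∈R with cov c c∈R
    ... | suc i , there i∈x , eq = i , i∈x , eq

    Covers-in⁺ : Covers (g ∘ suc) (R ∖ g zero) x → Covers g R (true ∷ x)
    Covers-in⁺ cov c c∈R with g zero Fin.≟ c
    ... | yes eq = zero , here , eq
    ... | no neq = let i , i∈x , eq = cov c (x∈p∧x≢y⇒x∈p-y c∈R (neq ∘ sym)) in suc i , there i∈x , eq

    Covers-in⁻ : Covers g R (true ∷ x) → Covers (g ∘ suc) (R ∖ g zero) x
    Covers-in⁻ cov c c∈ with cov c (p─q⊆p R ⁅ g zero ⁆ c∈)
    ... | zero , _ , refl = contradiction c∈ (i∉p∖i R c)
    ... | suc i , there i∈x , eq = i , i∈x , eq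

  Covers-[]⇒⊥ : {g : Fin 0 → Fin m} {R : Subset m} → Covers g R [] → R ≡ ⊥
  Covers-[]⇒⊥ cov = Empty-unique λ (c , c∈R) → contradiction (proj₁ (cov c c∈R)) λ ()

  -- A vertex is kept exactly when its colour is still demanded, which leaves one vertex for each
  -- colour of `R`. This gives both the lower bound on the size of full sets and a full set of the
  -- smallest size inside `x`.
  transversal : ∀ {n} (g : Fin n → Fin m) R x → Covers g R x → ∃ λ y → y ⊆ x × Covers g R y × ∣ y ∣ ≡ ∣ R ∣
  transversal g R [] cov = [] , ⊆-refl , cov , trans (sym (∣⊥∣≡0 m)) (cong ∣_∣ (sym (Covers-[]⇒⊥ cov)))
  transversal g R (false ∷ x) cov =
    let y , y⊆x , covy , eq = transversal (g ∘ suc) R x (Covers-out⁻ cov) in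
    false ∷ y , out⊆ y⊆x , Covers-out⁺ covy , eq
  transversal g R (true ∷ x) cov with g zero ∈? R
  ... | yes c∈R =
    let y , y⊆x , covy , eq = transversal (g ∘ suc) (R ∖ g zero) x (Covers-in⁻ cov) in
    true ∷ y , in⊆in y⊆x , Covers-in⁺ covy , trans (cong suc eq) (sym (∣∖∣ c∈R))
  ... | no c∉R =
    let y , y⊆x , covy , eq = transversal (g ∘ suc) R x cov′ in
    false ∷ y , out⊆ y⊆x , Covers-out⁺ covy , eq
    where
    cov′ : Covers (g ∘ suc) R x
    cov′ c c∈R = Covers-in⁻ cov c (x∈p∧x≢y⇒x∈p-y c∈R λ { refl → c∉R c∈R })

  -- Each colour class contributes a factor -1, the alternating sum over its non-empty subsets.
  signSum-covers : ∀ {n} (g : Fin n → Fin m) R x → Covers g R x → (∀ {i} → i ∈ˢ x → g i ∈ˢ R) →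
                   signSum (λ v → v ⊆? x ×-dec covers? g R v) ≡ sgn R
  signSum-covers g R [] cov _ = trans (signSum-[] (λ v → v ⊆? [] ×-dec covers? g R v) (⊆-refl , cov))
    (cong negOnePow (trans (sym (∣⊥∣≡0 m)) (cong ∣_∣ (sym (Covers-[]⇒⊥ cov)))))
  signSum-covers {suc n} g R (false ∷ x) cov x⊆R = trans (signSum-suc P?) (trans
    (cong₂ (λ a b → - a + b)
      (signSum-none (P? ∘ (true ∷_)) λ (v⊆x , _) → contradiction (v⊆x here) λ ())
      (trans (signSum-cong (P? ∘ (false ∷_)) (λ v → v ⊆? x ×-dec covers? (g ∘ suc) R v)
               (λ (v⊆x , covv) → drop-∷-⊆ v⊆x , Covers-out⁻ covv) (λ (v⊆x , covv) → out⊆ v⊆x , Covers-out⁺ covv))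
             (signSum-covers (g ∘ suc) R x (Covers-out⁻ cov) (x⊆R ∘ there))))
    (+-identityˡ _))
    where
    P? = λ v → v ⊆? (false ∷ x) ×-dec covers? g R v
  signSum-covers {suc n} g R (true ∷ x) cov x⊆R = trans (signSum-suc P?) (trans
    (cong₂ (λ a b → - a + b)
      (signSum-cong (P? ∘ (true ∷_)) A?
        (λ (v⊆x , covv) → drop-∷-⊆ v⊆x , Covers-in⁻ covv) (λ (v⊆x , covv) → in⊆in v⊆x , Covers-in⁺ covv))
      (signSum-cong (P? ∘ (false ∷_)) B?
        (λ (v⊆x , covv) → drop-∷-⊆ v⊆x , Covers-out⁻ covv) (λ (v⊆x , covv) → out⊆ v⊆x , Covers-out⁺ covv)))
    (total (Fin.any? λ i → i ∈? x ×-dec g (suc i) Fin.≟ g zero)))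
    where
    P? = λ v → v ⊆? (true ∷ x) ×-dec covers? g R v
    A? = λ v → v ⊆? x ×-dec covers? (g ∘ suc) (R ∖ g zero) v
    B? = λ v → v ⊆? x ×-dec covers? (g ∘ suc) R v
    -- If another vertex `i` of `x` shares the colour of the first one, the sets containing the
    -- first vertex cancel: they must cover `R ∖ g zero`, which is unaffected by toggling `i`. If
    -- the first vertex is alone in its colour, every covering set contains it, and its factor -1
    -- accounts for the colour removed from `R`.
    total : Dec (∃ λ i → i ∈ˢ x × g (suc i) ≡ g zero) → - signSum A? + signSum B? ≡ sgn R
    total (yes (i , i∈x , eq)) = trans
      (cong₂ (λ a b → - a + b) (signSum-toggle i A? toggle) (signSum-covers (g ∘ suc) R x cov′ (x⊆R ∘ there)))
      (+-identityˡ _)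
      where
      cov′ : Covers (g ∘ suc) R x
      cov′ c c∈R with cov c c∈R
      ... | zero , _ , eq′ = i , i∈x , trans eq eq′
      ... | suc j , there j∈x , eq′ = j , j∈x , eq′
      toggle : ∀ {z z′} → AgreeOff i z z′ → z ⊆ x × Covers (g ∘ suc) (R ∖ g zero) z →
               z′ ⊆ x × Covers (g ∘ suc) (R ∖ g zero) z′
      toggle {z} {z′} agree (z⊆x , covz) = z′⊆x , covz′
        where
        z′⊆x : z′ ⊆ x
        z′⊆x {j} j∈z′ with i Fin.≟ j
        ... | yes refl = i∈x
        ... | no i≢j   = z⊆x (AgreeOff-∈ {z = z′} (sym ∘ agree) i≢j j∈z′)
        covz′ : Covers (g ∘ suc) (R ∖ g zero) z′
        covz′ c c∈ with covz c c∈
        ... | j , j∈z , refl =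
          j , AgreeOff-∈ {z = z} agree (λ { refl → i∉p∖i R (g zero) (subst (_∈ˢ R ∖ g zero) eq c∈) }) j∈z , refl
    total (no ¬i) = trans
      (cong₂ (λ a b → - a + b)
        (signSum-covers (g ∘ suc) (R ∖ g zero) x (Covers-in⁻ cov)
          (λ {i} i∈x → x∈p∧x≢y⇒x∈p-y (x⊆R (there i∈x)) (λ eq → ¬i (i , i∈x , eq))))
        (signSum-none B? λ (v⊆x , covv) → let i , i∈v , eq = covv (g zero) (x⊆R here) in ¬i (i , v⊆x i∈v , eq)))
      (trans (+-identityʳ _) (cong negOnePow (sym (∣∖∣ (x⊆R here)))))

  Full : ∀ {n} → (Fin n → Fin m) → Subset n → Set
  Full g = Covers g ⊤

  full? : ∀ {n} (g : Fin n → Fin m) → Decidable (Full g)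
  full? g = covers? g ⊤

  Full⇒m≤ : ∀ {n} {g : Fin n → Fin m} {x} → Full g x → m ℕ.≤ ∣ x ∣
  Full⇒m≤ {g = g} {x} full = let y , y⊆x , _ , eq = transversal g ⊤ x full in
    ℕ.≤-trans (ℕ.≤-reflexive (trans (sym (∣⊤∣≡n m)) (sym eq))) (p⊆q⇒∣p∣≤∣q∣ y⊆x)

  signSum-Full-below : ∀ {n} (g : Fin n → Fin m) x → Full g x →
                       signSum (below? (full? g) x) ≡ negOnePow m - sgn x
  signSum-Full-below g x full = +-isolate (sgn x) (signSum (below? (full? g) x)) (begin
    sgn x + signSum (below? (full? g) x)
      ≡⟨ sym (signSum-remove (λ v → v ⊆? x ×-dec full? g v) (below? (full? g) x) x (⊆-refl , full)
           (⊂-irref refl ∘ proj₂) (λ (v⊆x , fv) v≢x → fv , ⊆∧≢⇒⊂ v⊆x v≢x) (λ (fv , v⊂x) → proj₁ v⊂x , fv)) ⟩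
    signSum (λ v → v ⊆? x ×-dec full? g v)
      ≡⟨ signSum-covers g ⊤ x full (λ _ → ∈⊤) ⟩
    sgn (⊤ {m})
      ≡⟨ cong negOnePow (∣⊤∣≡n m) ⟩
    negOnePow m ∎)
    where
    open ≡-Reasoning

  -- A superset of a full set is full, so the part above `v` is a whole open Boolean interval, while
  -- the part below `v` is of the same kind as the original. The recursion ends at |x| = m, where
  -- the size bound `Full⇒m≤` excludes any smaller full set.
  lower-Sphere : ∀ {n} (g : Fin n → Fin m) d {x} → Full g x → ∣ x ∣ ≡ m ℕ.+ d →
                 Sphere containAdj d (poset (below? (full? g) x))
  lower-Sphere {n} g d = go (suc d) d ℕ.≤-refl
    where
    go : ∀ b d {x} → d ℕ.< b → Full g x → ∣ x ∣ ≡ m ℕ.+ d → Sphere containAdj d (poset (below? (full? g) x))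
    go (suc b) zero {x} _ full size = Sphere-zero (below? (full? g) x) λ v (fv , v⊂x) →
      ℕ.<-irrefl (sym (trans size (ℕ.+-identityʳ m))) (ℕ.≤-<-trans (Full⇒m≤ fv) (p⊂q⇒∣p∣<∣q∣ v⊂x))
    go (suc b) (suc d) {x} (ℕ.s≤s d<b) full size = Sphere-suc (below? (full? g) x) d inhabited euler links
      where
      inhabited : ∃ λ v → Full g v × v ⊂ x
      inhabited with transversal g ⊤ x full
      ... | y , y⊆x , fy , eq = y , fy , ⊆∧≢⇒⊂ y⊆x λ { refl →
        ℕ.m≢1+m+n m (trans (sym (∣⊤∣≡n m)) (trans (sym eq) (trans size (ℕ.+-suc m d)))) }
      lower : ∀ v → Full g v → v ⊂ x → ∃₂ λ a c → a ℕ.+ c ≡ d × ∣ v ∣ ≡ m ℕ.+ a × ∣ x ∣ ≡ suc (∣ v ∣ ℕ.+ c) ×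
              Sphere containAdj a (poset (below? (below? (full? g) x) v))
      lower v fv v⊂x with ℕ.m≤n⇒∃[o]m+o≡n (Full⇒m≤ fv) | <⇒∃ (p⊂q⇒∣p∣<∣q∣ v⊂x)
      ... | a , eqv | c , eqx = a , c , a+c , sym eqv , eqx ,
        subst (Sphere containAdj a)
          (poset-cong (below? (full? g) v) (below? (below? (full? g) x) v)
            (λ (fu , u⊂v) → (fu , ⊂-trans u⊂v v⊂x) , u⊂v) (λ ((fu , _) , u⊂v) → fu , u⊂v))
          (go b a (ℕ.≤-<-trans (ℕ.m+n≤o⇒m≤o a (ℕ.≤-reflexive a+c)) d<b) fv (sym eqv))
        where
        open ≡-Reasoning
        a+c : a ℕ.+ c ≡ d
        a+c = ℕ.suc-injective (ℕ.+-cancelˡ-≡ m _ _ (begin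
          m ℕ.+ suc (a ℕ.+ c)       ≡⟨ ℕ.+-suc m (a ℕ.+ c) ⟩
          suc (m ℕ.+ (a ℕ.+ c))     ≡⟨ cong suc (sym (ℕ.+-assoc m a c)) ⟩
          suc (m ℕ.+ a ℕ.+ c)       ≡⟨ cong (λ s → suc (s ℕ.+ c)) eqv ⟩
          suc (∣ v ∣ ℕ.+ c)         ≡⟨ trans (sym eqx) size ⟩
          m ℕ.+ suc d               ∎))
      links : ∀ v → Full g v × v ⊂ x → ∃₂ λ a c → a ℕ.+ c ≡ d ×
              Sphere containAdj a (poset (below? (below? (full? g) x) v)) ×
              Sphere containAdj c (poset (above? (below? (full? g) x) v))
      links v (fv , v⊂x) with lower v fv v⊂x
      ... | a , c , a+c , _ , eqx , S↓ = a , c , a+c , S↓ ,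
        subst (Sphere containAdj c)
          (poset-cong (between? v x) (above? (below? (full? g) x) v)
            (λ (v⊂u , u⊂x) → (Covers-mono (proj₁ v⊂u) fv , u⊂x) , v⊂u) (λ ((_ , u⊂x) , v⊂u) → v⊂u , u⊂x))
          (interval-Sphere c v⊂x eqx)
      euler : e containAdj (poset (below? (full? g) x)) ≡ negOnePow (suc d)
      euler = begin
        e containAdj (poset (below? (full? g) x))
          -- Here |v| = m + a for the index a of the part below `v`, so the constant sign is (-1)^m.
          ≡⟨ e-poset (below? (full? g) x) s (λ v (fv , v⊂x) → let a , _ , _ , eqv , _ , S↓ = lower v fv v⊂x in
               trans (e-Sphere containAdj a S↓) (trans (sym (sign-absorb m a))
                 (cong (λ z → s * negOnePow z) (sym eqv)))) ⟩
        + 1 - s * signSum (below? (full? g) x)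
          ≡⟨ cong (λ z → + 1 - s * z) (signSum-Full-below g x full) ⟩
        + 1 - s * (s - sgn x)
          ≡⟨ expand s (sgn x) ⟩
        + 1 - s * s + s * sgn x
          ≡⟨ cong (λ z → + 1 - z + s * sgn x) (sign-square m) ⟩
        + 0 + s * sgn x
          ≡⟨ +-identityˡ _ ⟩
        s * sgn x
          ≡⟨ trans (cong (λ z → s * negOnePow z) size) (sign-absorb m (suc d)) ⟩
        negOnePow (suc d) ∎
        where
        open ≡-Reasoning
        s = negOnePow m
        expand : ∀ s t → + 1 - s * (s - t) ≡ + 1 - s * s + s * t
        expand = solve-∀

-- Dehn–Sommerville complexes

≡true⇒T : ∀ {b} → b ≡ true → T b
≡true⇒T = Equivalence.from T-≡

T⇒≡true : ∀ {b} → T b → b ≡ true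
T⇒≡true = Equivalence.to T-≡

≡false⇒¬T : ∀ {b} → b ≡ false → ¬ T b
≡false⇒¬T refl ()

does⁻ : ∀ {P : Set} (P? : Dec P) → T (does P?) → P
does⁻ (yes p) _ = p

does⁺ : ∀ {P : Set} (P? : Dec P) → P → T (does P?)
does⁺ (yes _) _ = _
does⁺ (no ¬p) p = contradiction p ¬p

InStar : ∀ {n} → SetOfSets n → Subset n → Pred (Subset n) 0ℓ
InStar A x z = ∃ λ y → T (A y) × x ⊆ y × z ⊆ y

module _ {n : ℕ} (A : SetOfSets n) (x z : Subset n) where

  private
    test : Subset n → Bool
    test y = A y ∧ (x ⊆ᵇ y) ∧ (z ⊆ᵇ y)

  starClosure⁻ : T (starClosure A x z) → T (A z) × InStar A x z
  starClosure⁻ t =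
    let az , t′ = Equivalence.to (T-∧ {A z}) t
        y , ty = satisfied (any⁻ test (subsets n) t′)
        ay , ty′ = Equivalence.to (T-∧ {A y}) ty
        tx , tz = Equivalence.to (T-∧ {x ⊆ᵇ y}) ty′
    in az , y , ay , does⁻ (x ⊆? y) tx , does⁻ (z ⊆? y) tz

  starClosure⁺ : T (A z) → InStar A x z → T (starClosure A x z)
  starClosure⁺ az (y , ay , x⊆y , z⊆y) = Equivalence.from (T-∧ {A z}) (az , any⁺ test (lose (subsets-complete y)
    (Equivalence.from (T-∧ {A y}) (ay , Equivalence.from (T-∧ {x ⊆ᵇ y})
      (does⁺ (x ⊆? y) x⊆y , does⁺ (z ⊆? y) z⊆y)))))

  unitSphere⁻ : T (unitSphere A x z) → T (A z) × InStar A x z × ¬ x ⊆ z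
  unitSphere⁻ t =
    let ts , t′ = Equivalence.to (T-∧ {starClosure A x z}) t
        az , star = starClosure⁻ ts
    in az , star , does⁻ (¬? (x ⊆? z)) t′

  unitSphere⁺ : T (A z) → InStar A x z → ¬ x ⊆ z → T (unitSphere A x z)
  unitSphere⁺ az star x⊈z = Equivalence.from (T-∧ {starClosure A x z})
    (starClosure⁺ az star , does⁺ (¬? (x ⊆? z)) x⊈z)

module Complex {n : ℕ} {A : SetOfSets n} (complex : IsComplex A) where

  nonempty : ∀ {x} → T (A x) → Nonempty x
  nonempty ax = proj₁ complex _ (T⇒≡true ax)

  face : ∀ {x y} → T (A y) → Nonempty x → x ⊆ y → T (A x)
  face ay nx x⊆y = ≡true⇒T (proj₂ complex _ _ (T⇒≡true ay) nx x⊆y)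

  ⊂-unitSphere : ∀ {x z} → T (A x) → Nonempty z → z ⊂ x → T (unitSphere A x z)
  ⊂-unitSphere {x} {z} ax nz z⊂x = unitSphere⁺ A x z (face ax nz (proj₁ z⊂x)) (x , ax , ⊆-refl , proj₁ z⊂x)
    λ x⊆z → ⊂-irref refl (⊂-⊆-trans z⊂x x⊆z)

  IsComplex-unitSphere : ∀ x → IsComplex (unitSphere A x)
  IsComplex-unitSphere x =
    (λ z sz → nonempty (proj₁ (unitSphere⁻ A x z (≡true⇒T sz)))) ,
    (λ w z sz nw w⊆z →
      let az , (y , ay , x⊆y , z⊆y) , x⊈z = unitSphere⁻ A x z (≡true⇒T sz) in
      T⇒≡true (unitSphere⁺ A x w (face az nw w⊆z) (y , ay , x⊆y , ⊆-trans w⊆z z⊆y) λ x⊆w → x⊈z (⊆-trans x⊆w w⊆z)))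

-- Purity. For maximal `x` the unit sphere consists of the proper non-empty faces of `x`, and a
-- facet `x ∖ i` is maximal in it. The unit sphere is again a complex, and a manifold of one
-- dimension less, so induction gives the size of the facet. At q = 0 the unit sphere is empty,
-- which forces `x` to be a single vertex.
maximal-size : ∀ {n} q {A : SetOfSets n} → IsComplex A → DSManifold q A →
               ∀ {x} → T (A x) → (∀ {y} → T (A y) → ¬ x ⊂ y) → ∣ x ∣ ≡ suc q
maximal-size {n} zero complex (_ , spheres) {x} ax max with Complex.nonempty complex ax
... | i , i∈x = trans (∣∖∣ i∈x) (cong suc (trans (cong ∣_∣ (Empty-unique empty)) (∣⊥∣≡0 n)))
  where
  empty : ¬ Nonempty (x ∖ i)
  empty nonempty = ≡false⇒¬T (spheres x (T⇒≡true ax) (x ∖ i))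
    (Complex.⊂-unitSphere complex ax nonempty (x∈p⇒p-x⊂p i∈x))
maximal-size {n} (suc q) {A} complex (_ , spheres) {x} ax max
  with spheres x (T⇒≡true ax)
... | sphere@((z , sz) , _) , _
  with unitSphere⁻ A x z (≡true⇒T sz)
... | az , (y , ay , x⊆y , z⊆y) , x⊈z = trans (∣∖∣ i∈x) (cong suc
    (maximal-size q (Complex.IsComplex-unitSphere complex x) sphere
      (Complex.⊂-unitSphere complex ax (map₂ z⊆x∖i (Complex.nonempty complex az)) (x∈p⇒p-x⊂p i∈x))
      facet-maximal))
  where
  top : ∀ {y} → T (A y) → x ⊆ y → y ⊆ x
  top {y} ay x⊆y with y ⊆? x
  ... | yes y⊆x = y⊆x
  ... | no y⊈x = contradiction (⊆∧≢⇒⊂ x⊆y λ { refl → y⊈x ⊆-refl }) (max ay)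
  z⊂x : z ⊂ x
  z⊂x = ⊆∧≢⇒⊂ (⊆-trans z⊆y (top ay x⊆y)) λ { refl → x⊈z ⊆-refl }
  -- A vertex of `x` missed by the member `z` of the unit sphere. The facet `x ∖ i` then contains
  -- `z`, so it is non-empty and belongs to the unit sphere.
  i = proj₁ (proj₂ z⊂x)
  i∈x = proj₁ (proj₂ (proj₂ z⊂x))
  z⊆x∖i : z ⊆ x ∖ i
  z⊆x∖i j∈z = x∈p∧x≢y⇒x∈p-y (proj₁ z⊂x j∈z) λ { refl → proj₂ (proj₂ (proj₂ z⊂x)) j∈z }
  facet-maximal : ∀ {u} → T (unitSphere A x u) → ¬ (x ∖ i) ⊂ u
  facet-maximal {u} su (x∖i⊆u , j , j∈u , j∉x∖i) =
    let au , (y , ay , x⊆y , u⊆y) , x⊈u = unitSphere⁻ A x u su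
        u⊆x : u ⊆ x
        u⊆x = ⊆-trans u⊆y (top ay x⊆y)
    in x⊈u λ {l} l∈x → x⊆u u⊆x l∈x
    where
    x⊆u : u ⊆ x → ∀ {l} → l ∈ˢ x → l ∈ˢ u
    x⊆u u⊆x {l} l∈x with l Fin.≟ i | j Fin.≟ i
    ... | no l≢i | _ = x∖i⊆u (x∈p∧x≢y⇒x∈p-y l∈x l≢i)
    ... | yes refl | yes refl = j∈u
    ... | yes _ | no j≢i = contradiction (x∈p∧x≢y⇒x∈p-y (u⊆x j∈u) j≢i) j∉x∖i

chi≡-signSum : ∀ {n} {A : SetOfSets n} → IsComplex A → chi A ≡ - signSum (T? ∘ A)
chi≡-signSum {n} {A} complex = trans (∑-cong term (subsets n)) (∑-neg _ (subsets n))
  where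
  omega : ∀ {m} (x : Subset m) → Nonempty x → omegaCard ∣ x ∣ ≡ - sgn x
  omega (true ∷ x) _ = sym (neg-involutive _)
  omega (false ∷ x) (suc i , there i∈x) = omega x (i , i∈x)
  term : ∀ x → when (A x) (omegaCard ∣ x ∣) ≡ - when (A x) (sgn x)
  term x with A x in ax
  ... | true  = omega x (Complex.nonempty complex (≡true⇒T ax))
  ... | false = refl

-- The prescribed value 1 + (-1)^(q-1), in a form that also gives 0 for the empty sphere at q = 0.
chi-DSSphere : ∀ {n} q {A : SetOfSets n} → DSSphere q A → chi A ≡ + 1 - negOnePow q
chi-DSSphere {n} zero {A} empty = trans (∑-cong term (subsets n)) (∑-zero (subsets n))
  where
  term : ∀ x → when (A x) (omegaCard ∣ x ∣) ≡ + 0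
  term x rewrite empty x = refl
chi-DSSphere (suc q) (_ , eq) = trans eq (cong (_+_ (+ 1)) (sym (neg-involutive (negOnePow q))))

⊂⇒Nonempty : ∀ {n} {x y : Subset n} → x ⊂ y → Nonempty y
⊂⇒Nonempty (_ , i , i∈y , _) = i , i∈y

-- Stars and upper parts in a Dehn-Sommerville manifold

module Manifold {n : ℕ} (q : ℕ) {G : SetOfSets n} (complex : IsComplex G) (manifold : DSManifold q G) where

  open Complex complex

  G? : Decidable (T ∘ G)
  G? = T? ∘ G

  extend : ∀ {x} → T (G x) → ∣ x ∣ ≡ suc q ⊎ (∃ λ y → T (G y) × x ⊂ y)
  extend {x} gx with anySubset? (above? G? x)
  ... | yes y∃ = inj₂ y∃
  ... | no none = inj₁ (maximal-size q complex manifold gx λ gy x⊂y → none (_ , gy , x⊂y))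

  -- Climbing through strictly larger simplices ends at one with q + 1 elements. The counter `b`
  -- bounds the number of remaining steps, of which there are at most n - |x|.
  size-≤ : ∀ {x} → T (G x) → ∣ x ∣ ℕ.≤ suc q
  size-≤ {x} = go n (ℕ.m≤m+n n ∣ x ∣)
    where
    go : ∀ b {x} → n ℕ.≤ b ℕ.+ ∣ x ∣ → T (G x) → ∣ x ∣ ℕ.≤ suc q
    go b {x} n≤ gx with extend gx
    ... | inj₁ eq = ℕ.≤-reflexive eq
    go zero {x} n≤ gx | inj₂ (y , gy , x⊂y) =
      contradiction (ℕ.<-≤-trans (p⊂q⇒∣p∣<∣q∣ x⊂y) (∣p∣≤n y)) (ℕ.≤⇒≯ n≤)
    go (suc b) {x} n≤ gx | inj₂ (y , gy , x⊂y) = ℕ.≤-trans (ℕ.<⇒≤ x<y) (go b n≤b+y gy)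
      where
      x<y = p⊂q⇒∣p∣<∣q∣ x⊂y
      n≤b+y = ℕ.≤-trans n≤ (ℕ.≤-trans (ℕ.≤-reflexive (sym (ℕ.+-suc b ∣ x ∣))) (ℕ.+-monoʳ-≤ b x<y))

  -- The closed star of x is a cone over any i ∈ x: toggling i in z preserves z ∪ x ∈ G.
  signSum-starClosure : ∀ {x} → T (G x) → signSum (T? ∘ starClosure G x) ≡ - + 1
  signSum-starClosure {x} gx with nonempty gx
  ... | i , i∈x = +-isolate (+ 1) (signSum (T? ∘ starClosure G x)) (begin
    + 1 + signSum (T? ∘ starClosure G x)
      ≡⟨ cong (λ z → negOnePow z + signSum (T? ∘ starClosure G x)) (sym (∣⊥∣≡0 n)) ⟩
    sgn (⊥ {n}) + signSum (T? ∘ starClosure G x)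
      ≡⟨ sym (signSum-remove joint? (T? ∘ starClosure G x) ⊥ (subst (T ∘ G) (sym (∪-identityˡ x)) gx)
           (λ t → ∉⊥ (proj₂ (nonempty (proj₁ (starClosure⁻ G x ⊥ t))))) joint⇒star star⇒joint) ⟩
    signSum joint?
      ≡⟨ signSum-toggle i joint? (λ agree → subst (T ∘ G) (∪-toggle agree)) ⟩
    + 0 ∎)
    where
    open ≡-Reasoning
    -- Besides the members of the closed star, this holds for the empty set, whose sign is the + 1
    -- split off above.
    joint? = λ z → T? (G (z ∪ x))
    nonempty-≢⊥ : ∀ {v : Subset n} → v ≢ ⊥ → Nonempty v
    nonempty-≢⊥ {v} v≢⊥ with nonempty? v
    ... | yes nv = nv
    ... | no ¬nv = contradiction (Empty-unique ¬nv) v≢⊥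
    joint⇒star : ∀ {v} → T (G (v ∪ x)) → v ≢ ⊥ → T (starClosure G x v)
    joint⇒star {v} gvx v≢⊥ = starClosure⁺ G x v (face gvx (nonempty-≢⊥ v≢⊥) (p⊆p∪q x))
      (v ∪ x , gvx , q⊆p∪q v x , p⊆p∪q x)
    star⇒joint : ∀ {v} → T (starClosure G x v) → T (G (v ∪ x))
    star⇒joint {v} t =
      let _ , y , gy , x⊆y , v⊆y = starClosure⁻ G x v t in
      face gy (i , q⊆p∪q v x i∈x) λ j∈ → [ v⊆y , x⊆y ] (x∈p∪q⁻ v x j∈)
    ∪-⊆ : ∀ {z z′} → AgreeOff i z z′ → z ∪ x ⊆ z′ ∪ x
    ∪-⊆ {z} {z′} agree {j} j∈ with i Fin.≟ j | x∈p∪q⁻ z x j∈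
    ... | yes refl | _        = q⊆p∪q z′ x i∈x
    ... | no _     | inj₂ j∈x = q⊆p∪q z′ x j∈x
    ... | no i≢j   | inj₁ j∈z = p⊆p∪q x (AgreeOff-∈ {z = z} agree i≢j j∈z)
    ∪-toggle : ∀ {z z′} → AgreeOff i z z′ → z ∪ x ≡ z′ ∪ x
    ∪-toggle {z} {z′} agree = ⊆-antisym (∪-⊆ {z} agree) (∪-⊆ {z′} (sym ∘ agree))

  -- The closed star is the disjoint union of unit sphere and star. Its sum is -1 and that of the
  -- unit sphere is -χ = (-1)^q - 1, which leaves -(-1)^q for the star.
  signSum-star : ∀ {x} → T (G x) → signSum (λ v → G? v ×-dec x ⊆? v) ≡ negOnePow (suc q)
  signSum-star {x} gx = solveFor _ _ _
    (trans (sym (signSum-starClosure gx))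
      (signSum-split (T? ∘ starClosure G x) (T? ∘ unitSphere G x) (λ v → G? v ×-dec x ⊆? v)
        split (λ {v} t → let gv , star , _ = unitSphere⁻ G x v t in starClosure⁺ G x v gv star)
        (λ {v} (gv , x⊆v) → starClosure⁺ G x v gv (v , gv , x⊆v , ⊆-refl))
        (λ {v} t (_ , x⊆v) → proj₂ (proj₂ (unitSphere⁻ G x v t)) x⊆v)))
    (trans (sym (chi≡-signSum (IsComplex-unitSphere x))) (chi-DSSphere q (proj₂ manifold x (T⇒≡true gx))))
    where
    split : ∀ {v} → T (starClosure G x v) → T (unitSphere G x v) ⊎ (T (G v) × x ⊆ v)
    split {v} t = decide (x ⊆? v)
      where
      decide : Dec (x ⊆ v) → T (unitSphere G x v) ⊎ (T (G v) × x ⊆ v)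
      decide (yes x⊆v) = inj₂ (proj₁ (starClosure⁻ G x v t) , x⊆v)
      decide (no x⊈v)  = let gv , star = starClosure⁻ G x v t in inj₁ (unitSphere⁺ G x v gv star x⊈v)
    solveFor : ∀ u w s → - + 1 ≡ u + w → - u ≡ + 1 - s → w ≡ - s
    solveFor u w s eq₁ eq₂ = trans (isolate u w) (trans (cong₂ _+_ (sym eq₁) eq₂) (cancel s))
      where
      isolate : ∀ u w → w ≡ u + w + - u
      isolate = solve-∀
      cancel : ∀ s → - + 1 + (+ 1 - s) ≡ - s
      cancel = solve-∀

  signSum-above : ∀ {x} → T (G x) → signSum (above? G? x) ≡ negOnePow (suc q) - sgn x
  signSum-above {x} gx = +-isolate (sgn x) _
    (trans (sym (signSum-remove (λ v → G? v ×-dec x ⊆? v) (above? G? x) x (gx , ⊆-refl)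
             (⊂-irref refl ∘ proj₂) (λ (gv , x⊆v) v≢x → gv , ⊆∧≢⇒⊂ x⊆v (v≢x ∘ sym))
             (λ (gv , x⊂v) → gv , proj₁ x⊂v)))
           (signSum-star gx))

  -- Closure under faces makes the part below `v` a whole open Boolean interval, while the part
  -- above `v` is of the same kind as the original. Purity supplies both ends of the induction:
  -- nothing lies above a simplex with q + 1 elements, and something lies above every smaller one.
  upper-Sphere : ∀ d {x} → T (G x) → suc q ≡ ∣ x ∣ ℕ.+ d → Sphere containAdj d (poset (above? G? x))
  upper-Sphere d = go (suc d) d ℕ.≤-refl
    where
    go : ∀ m d {x} → d ℕ.< m → T (G x) → suc q ≡ ∣ x ∣ ℕ.+ d → Sphere containAdj d (poset (above? G? x))
    go (suc m) zero {x} _ gx size = Sphere-zero (above? G? x) λ v (gv , x⊂v) →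
      ℕ.<-irrefl (sym (trans size (ℕ.+-identityʳ ∣ x ∣))) (ℕ.<-≤-trans (p⊂q⇒∣p∣<∣q∣ x⊂v) (size-≤ gv))
    go (suc m) (suc d) {x} (ℕ.s≤s d<m) gx size = Sphere-suc (above? G? x) d inhabited euler links
      where
      inhabited : ∃ λ v → T (G v) × x ⊂ v
      inhabited with extend gx
      ... | inj₁ eq = contradiction (trans eq (trans size (ℕ.+-suc ∣ x ∣ d))) (ℕ.m≢1+m+n ∣ x ∣)
      ... | inj₂ v∃ = v∃
      lower : ∀ v → T (G v) → x ⊂ v → ∃ λ a → ∣ v ∣ ≡ suc (∣ x ∣ ℕ.+ a) ×
              Sphere containAdj a (poset (below? (above? G? x) v))
      lower v gv x⊂v with <⇒∃ (p⊂q⇒∣p∣<∣q∣ x⊂v)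
      ... | a , eqv = a , eqv , subst (Sphere containAdj a)
        (poset-cong (between? x v) (below? (above? G? x) v)
          (λ (x⊂u , u⊂v) → (face gv (⊂⇒Nonempty x⊂u) (proj₁ u⊂v) , x⊂u) , u⊂v) (λ ((_ , x⊂u) , u⊂v) → x⊂u , u⊂v))
        (interval-Sphere a x⊂v eqv)
      links : ∀ v → T (G v) × x ⊂ v → ∃₂ λ a b → a ℕ.+ b ≡ d ×
              Sphere containAdj a (poset (below? (above? G? x) v)) ×
              Sphere containAdj b (poset (above? (above? G? x) v))
      links v (gv , x⊂v) with lower v gv x⊂v | ℕ.m≤n⇒∃[o]m+o≡n (size-≤ gv)
      ... | a , eqv , S↓ | b , eqq = a , b , a+b , S↓ , subst (Sphere containAdj b)
          (poset-cong (above? G? v) (above? (above? G? x) v)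
            (λ (gu , v⊂u) → (gu , ⊂-trans x⊂v v⊂u) , v⊂u) (λ ((gu , _) , v⊂u) → gu , v⊂u))
          (go m b (ℕ.≤-<-trans (ℕ.m+n≤o⇒n≤o a (ℕ.≤-reflexive a+b)) d<m) gv (sym eqq))
        where
        open ≡-Reasoning
        a+b : a ℕ.+ b ≡ d
        a+b = ℕ.suc-injective (ℕ.+-cancelˡ-≡ ∣ x ∣ _ _ (begin
          ∣ x ∣ ℕ.+ suc (a ℕ.+ b)       ≡⟨ ℕ.+-suc ∣ x ∣ (a ℕ.+ b) ⟩
          suc (∣ x ∣ ℕ.+ (a ℕ.+ b))     ≡⟨ cong suc (sym (ℕ.+-assoc ∣ x ∣ a b)) ⟩
          suc (∣ x ∣ ℕ.+ a) ℕ.+ b       ≡⟨ cong (ℕ._+ b) (sym eqv) ⟩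
          ∣ v ∣ ℕ.+ b                   ≡⟨ trans eqq size ⟩
          ∣ x ∣ ℕ.+ suc d               ∎))
      euler : e containAdj (poset (above? G? x)) ≡ negOnePow (suc d)
      euler = begin
        e containAdj (poset (above? G? x))
          -- As for intervals, the part below `v` has index |v| - |x| - 1, whence the constant
          -- `- sgn x`.
          ≡⟨ e-poset (above? G? x) (- s) (λ v (gv , x⊂v) → let a , eqv , S↓ = lower v gv x⊂v in
               trans (e-Sphere containAdj a S↓) (trans (sym (sign-absorb-suc ∣ x ∣ a))
                 (cong (λ z → - s * negOnePow z) (sym eqv)))) ⟩
        + 1 - - s * signSum (above? G? x)
          ≡⟨ cong (λ z → + 1 - - s * z) (signSum-above {x} gx) ⟩
        + 1 - - s * (negOnePow (suc q) - s)
          ≡⟨ expand s (negOnePow (suc q)) ⟩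
        + 1 - s * s + s * negOnePow (suc q)
          ≡⟨ cong (λ z → + 1 - z + s * negOnePow (suc q)) (sign-square ∣ x ∣) ⟩
        + 0 + s * negOnePow (suc q)
          ≡⟨ +-identityˡ _ ⟩
        s * negOnePow (suc q)
          ≡⟨ trans (cong (λ z → s * negOnePow z) size) (sign-absorb ∣ x ∣ (suc d)) ⟩
        negOnePow (suc d) ∎
        where
        open ≡-Reasoning
        s = sgn x
        expand : ∀ s t → + 1 - - s * (t - s) ≡ + 1 - s * s + s * t
        expand = solve-∀

-- Unit spheres in the fully coloured part of the complex

module _ {n k : ℕ} (g : Fin n → Fin (suc k)) where

  private
    hasColour : Subset n → Fin (suc k) → Fin n → Bool
    hasColour x c v = lookup x v ∧ does (g v Fin.≟ c)

  fullColour⁻ : ∀ x → T (fullColour g x) → Full g x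
  fullColour⁻ x t c _ =
    let v , tv = satisfied (any⁻ (hasColour x c) (allFin n)
                   (All.lookup (All.all⁺ (λ c → any (hasColour x c) (allFin n)) (allFin (suc k)) t) (∈-allFin c)))
        tx , tc = Equivalence.to (T-∧ {lookup x v}) tv
    in v , lookup⇒[]= v x (T⇒≡true tx) , does⁻ (g v Fin.≟ c) tc

  fullColour⁺ : ∀ x → Full g x → T (fullColour g x)
  fullColour⁺ x full = All.all⁻ (λ c → any (hasColour x c) (allFin n)) {xs = allFin (suc k)} (All.tabulate λ {c} _ →
    let v , v∈x , eq = full c ∈⊤ in
    any⁺ (hasColour x c) (lose (∈-allFin v)
      (Equivalence.from (T-∧ {lookup x v}) (≡true⇒T ([]=⇒lookup v∈x) , does⁺ (g v Fin.≟ c) eq))))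

mainTheorem2 : (n q k : ℕ) (G : SetOfSets n) → IsComplex G → DSManifold q G →
    1 ≤ k → (g : Fin n → Fin (suc k)) →
    (∃ λ x → Gg G g x ≡ true) →
    GDSManifold containAdj (q ∸ k) (GgList G g)
mainTheorem2 n q k G complex manifold _ g (x , gx) =
  GDSManifold-intro containAdj (x , ∈-poset⁺ U? (≡true⇒T gx)) λ {v} v∈ →
    Sphere⇒GDSSphere containAdj (q ∸ k) (unit-sphere v (∈-poset⁻ U? v∈))
  where
  open Manifold q complex manifold
  open Complex complex

  U? : Decidable (T ∘ Gg G g)
  U? = T? ∘ Gg G g

  U⁻ : ∀ {v} → T (Gg G g v) → T (G v) × Full g v
  U⁻ {v} t = map₂ (fullColour⁻ g v) (Equivalence.to (T-∧ {G v}) t)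

  U⁺ : ∀ {v} → T (G v) → Full g v → T (Gg G g v)
  U⁺ {v} gv full = Equivalence.from (T-∧ {G v}) (gv , fullColour⁺ g v full)

  Full⇒Nonempty : ∀ {v} → Full g v → Nonempty v
  Full⇒Nonempty full = let i , i∈v , _ = full zero ∈⊤ in i , i∈v

  unit-sphere : ∀ v → T (Gg G g v) → Sphere containAdj (q ∸ k) (link containAdj v (poset U?))
  unit-sphere v uv with U⁻ {v} uv
  ... | gv , full with ℕ.m≤n⇒∃[o]m+o≡n (Full⇒m≤ full) | ℕ.m≤n⇒∃[o]m+o≡n (size-≤ gv)
  ...   | a , eqv | b , eqq = link-Sphere U? a b a+b
    -- A full set is non-empty, so below a simplex `v` fullness already implies membership in `G`.
    (subst (Sphere containAdj a)
      (poset-cong (below? (full? g) v) (below? U? v)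
        (λ {u} (fu , u⊂v) → U⁺ {u} (face gv (Full⇒Nonempty fu) (proj₁ u⊂v)) fu , u⊂v)
        (λ {u} (uu , u⊂v) → proj₂ (U⁻ {u} uu) , u⊂v))
      (lower-Sphere g a full (sym eqv)))
    -- Fullness of `v` passes to all larger sets, so above `v` only membership in `G` remains as a
    -- condition.
    (subst (Sphere containAdj b)
      (poset-cong (above? G? v) (above? U? v)
        (λ {u} (gu , v⊂u) → U⁺ {u} gu (Covers-mono (proj₁ v⊂u) full) , v⊂u)
        (λ {u} (uu , v⊂u) → proj₁ (U⁻ {u} uu) , v⊂u))
      (upper-Sphere b gv (sym eqq)))
    where
    open ≡-Reasoning
    -- From |v| = k + 1 + a and |v| + b = q + 1 it follows that k + a + b = q; hence k is at most q
    -- and the truncated difference is the true one.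
    a+b : a ℕ.+ b ≡ q ∸ k
    a+b = begin
      a ℕ.+ b                   ≡⟨ sym (ℕ.m+n∸m≡n k (a ℕ.+ b)) ⟩
      k ℕ.+ (a ℕ.+ b) ∸ k     ≡⟨ cong (ℕ._∸ k) (sym (ℕ.+-assoc k a b)) ⟩
      k ℕ.+ a ℕ.+ b ∸ k       ≡⟨ cong (ℕ._∸ k) (ℕ.suc-injective (trans (cong (ℕ._+ b) eqv) eqq)) ⟩
      q ∸ k                   ∎
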